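{- For all integers $n \geq 1$, the following expressions (polynomials in $z$ with coefficients that are Laurent polynomials in $q$) are all equal: \begin{align*} \sum_{k=0}^{n-1} \Big(\sum_{(\sigma,S)\in \mathfrak{S}^{>}_{n,k}} q^{\operatorname{inv}((\sigma,S))}\Big) z^{k} &= \sum_{k=0}^{n-1} \Big(\sum_{(\sigma,S)\in \mathfrak{S}^{>}_{n,k}} q^{\operatorname{maj}((\sigma,S))}\Big) z^{k} =\sum_{k=1}^n [k]_q!\, S_{n,k}(q)\, z^{n-k}\\ &=\sum_{\sigma \in \mathfrak{S}_{n}} q^{\operatorname{inv}(\sigma)} \prod_{j \in \operatorname{Des}(\sigma)} \left(1 + \frac{z}{q^{1 + \operatorname{inv}^{\Box, j}(\sigma)}} \right) \\ &=\sum_{\sigma \in \mathfrak{S}_{n}} q^{\operatorname{inv}(\sigma)} \prod_{j \in \operatorname{Asc}(\sigma)} \left(1 + \frac{z}{q^{\operatorname{inv}^{\Box, j+1}(\sigma)}} \right) \\ &= \sum_{\sigma \in \mathfrak{S}_{n}} q^{\operatorname{maj}(\sigma)} \prod_{j = 1}^{\operatorname{des}(\sigma)} \left(1 + \frac{z}{q^{j}} \right). \end{align*}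
   Context: $\mathfrak{S}_n$ is the set of permutations $\sigma=\sigma_1\cdots\sigma_n$ of $\{1,\dots,n\}$. For $\sigma\in\mathfrak{S}_n$: $\operatorname{Des}(\sigma)=\{i\in\{1,\dots,n-1\}:\sigma_i>\sigma_{i+1}\}$, $\operatorname{Asc}(\sigma)=\{i\in\{1,\dots,n-1\}:\sigma_i<\sigma_{i+1}\}$, $\operatorname{des}(\sigma)=|\operatorname{Des}(\sigma)|$, $\operatorname{maj}(\sigma)=\sum_{i\in\operatorname{Des}(\sigma)}i$, $\operatorname{inv}(\sigma)=|\{(i,j):1\le i<j\le n,\ \sigma_i>\sigma_j\}|$, and $\operatorname{inv}^{\Box,j}(\sigma)=|\{i: 1\le i<j,\ \sigma_i>\sigma_j\}|$. $\mathfrak{S}^{>}_{n,k}=\{(\sigma,S):\sigma\in\mathfrak{S}_n,\ S\subseteq\operatorname{Des}(\sigma),\ |S|=k\}$ (descent-starred permutations; $S$ is the set of starred positions). For $(\sigma,S)\in\mathfrak{S}^{>}_{n,k}$, $$\operatorname{inv}((\sigma,S))=\operatorname{inv}(\sigma)-\sum_{i\in S}\big(1+\operatorname{inv}^{\Box,i}(\sigma)\big),\qquad \operatorname{maj}((\sigma,S))=\operatorname{maj}(\sigma)-\sum_{i\in S}|\operatorname{Des}(\sigma)\cap\{i,i+1,\dots,n-1\}|.$$ $[k]_q=1+q+\cdots+q^{k-1}$ and $[k]_q!=[1]_q[2]_q\cdots[k]_q$. The $q$-Stirling numbers $S_{n,k}(q)$ are defined by $S_{0,0}(q)=1$, $S_{n,k}(q)=0$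 if $k<0$ or $k>n$, and $S_{n+1,k}(q)=S_{n,k-1}(q)+[k]_qS_{n,k}(q)$. -}

module Defs where

open import Algebra.Bundles.Raw using (RawRing)
open import Algebra.Core using (Op₂)
open import Data.Bool.Base using (if_then_else_)
open import Data.Fin.Base using (Fin; suc; toℕ; inject₁)
import Data.Fin.Base as Fin
import Data.Fin.Properties as Fin
open import Data.Fin.Subset using (Subset; inside; outside; ∣_∣; _∩_)
open import Data.Fin.Subset.Properties using (_∈?_; _⊆?_)
open import Data.Integer.Base using (ℤ; +_)
import Data.Integer.Base as ℤ
import Data.Integer.Properties as ℤ
open import Data.List.Base
  using (List; []; _∷_; [_]; _++_; map; foldr; filter; length; allFin;
         upTo; applyUpTo; cartesianProduct; cartesianProductWith)
open import Data.Nat.Base using (ℕ; zero; suc; pred)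
import Data.Nat.Base as ℕ
open import Data.Nat.ListAction using (sum)
import Data.Nat.Properties as ℕ
open import Data.Product.Base using (_×_; _,_)
open import Data.Vec.Base using (Vec; lookup; tabulate)
import Data.Vec.Base as Vec
open import Data.Vec.Relation.Unary.AllPairs using (allPairs?)
open import Data.Vec.Relation.Unary.Unique.Propositional using (Unique)
open import Level using (0ℓ)
open import Relation.Binary.Definitions using (DecidableEquality)
open import Relation.Nullary.Decidable using (Dec; does; ¬?; _×-dec_)

------------------------------------------------------------------------
-- Laurent polynomials in q and polynomials in z

-- The monoid ring R[E]: a finite list of terms (c , e) stands for the sum
-- of the c·xᵉ.  Exponents may repeat and coefficients may vanish, so
-- equality is equality of all coefficients.
module MonoidRing (R : RawRing 0ℓ 0ℓ) {E : Set}
                  (_∙_ : Op₂ E) (ε : E) (_≟_ : DecidableEquality E) where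

  private module R = RawRing R

  coeff : List (R.Carrier × E) → E → R.Carrier
  coeff p e = foldr (λ (c , d) s → (if does (d ≟ e) then c else R.0#) R.+ s) R.0# p

  monomial : R.Carrier → E → List (R.Carrier × E)
  monomial c e = [ (c , e) ]

  rawRing : RawRing 0ℓ 0ℓ
  rawRing = record
    { Carrier = List (R.Carrier × E)
    ; _≈_     = λ p r → ∀ e → coeff p e R.≈ coeff r e
    ; _+_     = _++_
    ; _*_     = cartesianProductWith (λ (c , d) (c′ , d′) → (c R.* c′ , d ∙ d′))
    ; -_      = map (λ (c , d) → (R.- c , d))
    ; 0#      = []
    ; 1#      = monomial R.1# ε
    }

module FiniteSums (R : RawRing 0ℓ 0ℓ) where
  open RawRing R

  ∑ : {A : Set} → List A → (A → Carrier) → Carrier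
  ∑ xs f = foldr (λ x s → f x + s) 0# xs

  ∏ : {A : Set} → List A → (A → Carrier) → Carrier
  ∏ xs f = foldr (λ x s → f x * s) 1# xs

module ℤ[q^±1] = MonoidRing ℤ.+-*-rawRing ℤ._+_ (+ 0) ℤ._≟_
module ℤ[q^±1][z] = MonoidRing ℤ[q^±1].rawRing ℕ._+_ 0 ℕ._≟_

open RawRing ℤ[q^±1].rawRing public
  using () renaming (Carrier to Laurent; _+_ to _+ᴸ_; _*_ to _*ᴸ_; 0# to 0ᴸ; 1# to 1ᴸ)
open FiniteSums ℤ[q^±1].rawRing public
  using () renaming (∑ to ∑ᴸ; ∏ to ∏ᴸ)

open RawRing ℤ[q^±1][z].rawRing public
  using () renaming (Carrier to Poly; _≈_ to _≈ᴾ_; _+_ to _+ᴾ_; _*_ to _*ᴾ_; 1# to 1ᴾ)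
open FiniteSums ℤ[q^±1][z].rawRing public
  using () renaming (∑ to ∑ᴾ; ∏ to ∏ᴾ)

q^ : ℤ → Laurent
q^ = ℤ[q^±1].monomial (+ 1)

infix 8 _·z^_

_·z^_ : Laurent → ℕ → Poly
c ·z^ k = ℤ[q^±1][z].monomial c k

------------------------------------------------------------------------
-- q-analogues

[_]q : ℕ → Laurent
[ k ]q = ∑ᴸ (upTo k) (λ i → q^ (+ i))

[_]q! : ℕ → Laurent
[ k ]q! = ∏ᴸ (applyUpTo suc k) [_]q

-- S_{n+1,0} = S_{n,-1} + [0]_q S_{n,0} with S_{n,-1} = 0.  For k > n the
-- recurrence already yields the empty sum, as required.
qStirling : ℕ → ℕ → Laurent
qStirling zero    zero    = 1ᴸ
qStirling zero    (suc k) = 0ᴸ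
qStirling (suc n) zero    = 0ᴸ +ᴸ [ 0 ]q *ᴸ qStirling n zero
qStirling (suc n) (suc k) = qStirling n k +ᴸ [ suc k ]q *ᴸ qStirling n (suc k)

------------------------------------------------------------------------
-- Permutations

-- One-line notation, with letters and positions shifted from {1,…,n} to
-- {0,…,n-1}.
Word : ℕ → Set
Word n = Vec (Fin n) n

words : {A : Set} → List A → (n : ℕ) → List (Vec A n)
words as zero    = [ Vec.[] ]
words as (suc n) = cartesianProductWith Vec._∷_ as (words as n)

unique? : ∀ {n m} (w : Vec (Fin n) m) → Dec (Unique w)
unique? = allPairs? (λ a b → ¬? (a Fin.≟ b))

𝔖 : (n : ℕ) → List (Word n)
𝔖 n = filter unique? (words (allFin n) n)

-- The element i of Fin (pred n) stands for the position index i+1 in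
-- {1,…,n-1}; here i and next i are the positions i+1 and i+2 of the word.
here next : ∀ {n} → Fin (pred n) → Fin n
here {suc n} i = inject₁ i
next {suc n} i = suc i

index : ∀ {m} → Fin m → ℕ
index i = suc (toℕ i)

Des Asc : ∀ {n} → Word n → Subset (pred n)
Des σ = tabulate (λ i → does (lookup σ (next i) Fin.<? lookup σ (here i)))
Asc σ = tabulate (λ i → does (lookup σ (here i) Fin.<? lookup σ (next i)))

elements : ∀ {m} → Subset m → List (Fin m)
elements {m} S = filter (_∈? S) (allFin m)

des maj inv : ∀ {n} → Word n → ℕ
des σ = ∣ Des σ ∣
maj σ = sum (map index (elements (Des σ)))
inv {n} σ = length (filter
  (λ (i , j) → (i Fin.<? j) ×-dec (lookup σ j Fin.<? lookup σ i))
  (cartesianProduct (allFin n) (allFin n)))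

inv□ : ∀ {n} → Fin n → Word n → ℕ
inv□ {n} j σ = length (filter
  (λ i → (i Fin.<? j) ×-dec (lookup σ j Fin.<? lookup σ i))
  (allFin n))

------------------------------------------------------------------------
-- Descent-starred permutations

𝔖> : (n k : ℕ) → List (Word n × Subset (pred n))
𝔖> n k = filter
  (λ (σ , S) → (S ⊆? Des σ) ×-dec (∣ S ∣ ℕ.≟ k))
  (cartesianProduct (𝔖 n) (words (outside ∷ inside ∷ []) (pred n)))

-- {i, i+1, …, n-1}
from : ∀ {m} → Fin m → Subset m
from i = tabulate (λ j → does (i Fin.≤? j))

inv* maj* : ∀ {n} → Word n × Subset (pred n) → ℤ
inv* (σ , S) =
  + inv σ ℤ.- + sum (map (λ i → 1 ℕ.+ inv□ (here i) σ) (elements S))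
maj* (σ , S) =
  + maj σ ℤ.- + sum (map (λ i → ∣ Des σ ∩ from i ∣) (elements S))

{-# OPTIONS --safe #-}
-- In the Lehmer code c = (inv□ 1, …, inv□ n) of a permutation, position j is a
-- descent exactly when c_j < c_{j+1}, and inv is the sum of the code.  So each
-- of the sums over permutations can be computed by a transfer matrix that
-- appends a last letter and remembers only the last code entry c.  Restricted
-- to last entry c, the sums for (inv, Des) and (maj, des) agree: both satisfy
--   K(n+1, 0) = Σ_{c ≤ n} K(n, c),   K(n+1, c+1) = q K(n+1, c) + z K(n, c),
-- where K(n, c) counts permutations of n + 1 letters.  For (inv, Asc) the sum
-- over last entries ≥ c equals q^c Σ_{i < n+1-c} K(n, i).
-- The total of K is evaluated umbrally: if L is the linear functional with
-- L(∏_{i<k} (x - z[i])) = [k]!, then K(n, c) = L(x^{n-c} (q x + z)^c) and the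
-- total is L(x^{n+1}); the coefficients of x^n in the basis ∏_{i<k} (x - z[i])
-- are S_{n,k}(q) z^{n-k}.  The starred sums expand the products over Des.
module Submission where

open import Defs
open import Algebra.Bundles using (CommutativeMonoid; CommutativeRing)
open import Algebra.Bundles.Raw using (RawRing)
open import Algebra.Core using (Op₂)
import Algebra.Properties.CommutativeMonoid.Sum as VectorSum
import Algebra.Properties.CommutativeSemigroup as CommutativeSemigroupProperties
import Algebra.Properties.Ring as RingProperties
import Algebra.Properties.Semiring.Exp as Exp
import Algebra.Solver.Ring.NaturalCoefficients.Default as SemiringSolver
open import Algebra.Structures using (IsCommutativeMonoid; IsCommutativeRing)
open import Data.Bool.Base using (Bool; true; false; if_then_else_; not; _∧_)
open import Data.Fin.Base using (Fin; zero; suc; toℕ; fromℕ; inject₁; punchIn; punchOut)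
import Data.Fin.Base as Fin
import Data.Fin.Properties as Fin
open import Data.Fin.Relation.Unary.Top using (view; ‵fromℕ; ‵inject₁)
open import Data.Fin.Subset using (Subset; inside; outside; ∣_∣; _∩_; ⊤)
open import Data.Fin.Subset.Properties using (_∈?_; _⊆?_; ∣p∣≤n; ∩-identityʳ)
open import Data.Integer.Base using (ℤ; +_; -_)
import Data.Integer.Base as ℤ
import Data.Integer.Properties as ℤ
open import Data.List.Base
  using (List; []; _∷_; _++_; map; foldr; filter; length; allFin; upTo; applyUpTo;
         deduplicate; cartesianProduct; cartesianProductWith)
import Data.List.Base as List
open import Data.List.Membership.Propositional using (_∈_)
open import Data.List.Membership.Propositional.Properties
  using (∈-map⁺; ∈-++⁺ˡ; ∈-++⁺ʳ; ∈-deduplicate⁺; ∈-filter⁺; ∈-filter⁻; ∈-allFin;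
         ∈-cartesianProductWith⁺; ∈-cartesianProductWith⁻)
open import Data.List.Membership.Propositional.Properties.WithK using (unique∧set⇒bag)
open import Data.List.Relation.Binary.BagAndSetEquality using (∼bag⇒↭)
open import Data.List.Relation.Binary.Permutation.Propositional using (_↭_)
import Data.List.Relation.Binary.Permutation.Propositional as ↭
open import Data.List.Relation.Unary.All as All using (All; []; _∷_)
open import Data.List.Relation.Unary.AllPairs using ([]; _∷_)
import Data.List.Relation.Unary.Any as Any
import Data.List.Relation.Unary.Unique.Propositional as List
import Data.List.Relation.Unary.Unique.Propositional.Properties as List
open import Data.List.Relation.Unary.Unique.DecPropositional.Properties using (deduplicate-!)
open import Data.Nat.Base as ℕ using (ℕ; zero; suc; _∸_; _≤_; _<_; _<ᵇ_; z≤n; s≤s)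
open import Data.Nat.ListAction using () renaming (sum to listSum)
import Data.Nat.Properties as ℕ
open import Data.Product.Base using (∃₂; _×_; _,_; proj₂)
open import Data.Sum.Base using (inj₁; inj₂)
open import Data.Vec.Base using (Vec; []; _∷_; _∷ʳ_; lookup; tabulate)
import Data.Vec.Base as Vec
open import Data.Vec.Properties
  using (∷-injective; ∷ʳ-injective; lookup-map; lookup∘tabulate; tabulate∘lookup; tabulate-cong)
open import Data.Vec.Relation.Unary.Unique.Propositional using (Unique)
import Data.Vec.Relation.Unary.Unique.Propositional.Properties as Vec
open import Function.Base using (_∘_; id)
open import Function.Bundles using (_⇔_; mk⇔; module Equivalence)
open import Level using (0ℓ)
open import Relation.Binary.Definitions using (DecidableEquality; tri<; tri≈; tri>)
open import Relation.Binary.PropositionalEquality as ≡ using (_≡_; _≢_)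
open import Relation.Nullary.Decidable using (Dec; does; does-⇔; dec-true; dec-false; _×-dec_)
open import Relation.Nullary.Negation using (contradiction)
open import Relation.Unary using (Decidable)

-- Why a recurrence in c: passing from c to c + 1 moves a threshold past a single previous code
-- entry, so all but one summand agree. For ascents the factor z/q^c depends on the new entry
-- instead of the old one; the sums at a fixed last entry then differ from K, and only tail sums are
-- comparable. For maj the factors depend on how many descents there are and not on code entries, so
-- a further parameter s is carried along. Why this L: put y = q x + z. The first recurrence of K
-- asks that L(x^{n+1}) = L((x^{n+1} - y^{n+1})/(x - y)), that is, L must be invariant under a
-- divided difference on multiples of x. The nodes z[i] are the iterates of 0 under x -> q x + z,
-- which is what makes the divided difference send the k-th basis polynomial to [k] times the
-- previous one. Invariance then forces the values [k]!. The second recurrence of K only expands one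
-- factor y.

module FiniteSum (M : CommutativeMonoid 0ℓ 0ℓ) where

  open CommutativeMonoid M
  open CommutativeSemigroupProperties commutativeSemigroup using (interchange; x∙yz≈y∙xz)
  open import Relation.Binary.Reasoning.Setoid setoid
  open VectorSum M public using (sum; sum-cong-≋; sum-init-last; sum-remove)

  private variable
    A B C : Set

  -- Agrees definitionally with the `∑` and `∏` of the statement, so the results apply to them
  -- without conversion.
  fold : List A → (A → Carrier) → Carrier
  fold xs f = foldr (λ x s → f x ∙ s) ε xs

  -- The term of largest index enters last, so lengthening the range of code entries by one unfolds
  -- by computation.
  foldTo : ℕ → (ℕ → Carrier) → Carrier
  foldTo zero    f = ε
  foldTo (suc n) f = foldTo n f ∙ f n

  fold-cong-∈ : ∀ (xs : List A) {f g} → (∀ {x} → x ∈ xs → f x ≈ g x) → fold xs f ≈ fold xs g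
  fold-cong-∈ []       f≈g = refl
  fold-cong-∈ (x ∷ xs) f≈g = ∙-cong (f≈g (Any.here ≡.refl)) (fold-cong-∈ xs (f≈g ∘ Any.there))

  fold-cong : ∀ (xs : List A) {f g} → (∀ x → f x ≈ g x) → fold xs f ≈ fold xs g
  fold-cong xs f≈g = fold-cong-∈ xs (λ {x} _ → f≈g x)

  fold-ε : ∀ (xs : List A) → fold xs (λ _ → ε) ≈ ε
  fold-ε []       = refl
  fold-ε (x ∷ xs) = trans (identityˡ _) (fold-ε xs)

  fold-∙ : ∀ (xs : List A) (f g : A → Carrier) → fold xs (λ x → f x ∙ g x) ≈ fold xs f ∙ fold xs g
  fold-∙ []       f g = sym (identityˡ ε)
  fold-∙ (x ∷ xs) f g = trans (∙-congˡ (fold-∙ xs f g)) (interchange _ _ _ _)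

  fold-comm : ∀ (xs : List A) (ys : List B) (f : A → B → Carrier) →
              fold xs (λ x → fold ys (f x)) ≈ fold ys (λ y → fold xs (λ x → f x y))
  fold-comm []       ys f = sym (fold-ε ys)
  fold-comm (x ∷ xs) ys f =
    trans (∙-congˡ (fold-comm xs ys f)) (sym (fold-∙ ys (f x) (λ y → fold xs (λ x → f x y))))

  fold-++ : ∀ (xs ys : List A) f → fold (xs ++ ys) f ≈ fold xs f ∙ fold ys f
  fold-++ []       ys f = sym (identityˡ _)
  fold-++ (x ∷ xs) ys f = trans (∙-congˡ (fold-++ xs ys f)) (sym (assoc _ _ _))

  fold-map : ∀ (h : A → B) xs f → fold (map h xs) f ≡ fold xs (f ∘ h)
  fold-map h []       f = ≡.refl
  fold-map h (x ∷ xs) f = ≡.cong (f (h x) ∙_) (fold-map h xs f)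

  fold-product : ∀ (h : A → B → C) xs ys f →
                 fold (cartesianProductWith h xs ys) f ≈ fold xs (λ x → fold ys (λ y → f (h x y)))
  fold-product h []       ys f = refl
  fold-product h (x ∷ xs) ys f = begin
    fold (map (h x) ys ++ cartesianProductWith h xs ys) f
      ≈⟨ fold-++ (map (h x) ys) _ f ⟩
    fold (map (h x) ys) f ∙ fold (cartesianProductWith h xs ys) f
      ≈⟨ ∙-cong (reflexive (fold-map (h x) ys f)) (fold-product h xs ys f) ⟩
    fold ys (f ∘ h x) ∙ fold xs (λ x → fold ys (λ y → f (h x y))) ∎

  fold-filter : ∀ {P : A → Set} (P? : Decidable P) xs f →
                fold (filter P? xs) f ≈ fold xs (λ x → if does (P? x) then f x else ε)
  fold-filter P? []       f = refl
  fold-filter P? (x ∷ xs) f with does (P? x)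
  ... | true  = ∙-congˡ (fold-filter P? xs f)
  ... | false = trans (fold-filter P? xs f) (sym (identityˡ _))

  fold≈foldr-map : ∀ (xs : List A) f → fold xs f ≡ foldr _∙_ ε (map f xs)
  fold≈foldr-map []       f = ≡.refl
  fold≈foldr-map (x ∷ xs) f = ≡.cong (f x ∙_) (fold≈foldr-map xs f)

  fold-↭ : ∀ {xs ys : List A} f → xs ↭ ys → fold xs f ≈ fold ys f
  fold-↭ f ↭.refl          = refl
  fold-↭ f (↭.prep x p)    = ∙-congˡ (fold-↭ f p)
  fold-↭ f (↭.swap x y p)  = trans (∙-congˡ (∙-congˡ (fold-↭ f p))) (x∙yz≈y∙xz _ _ _)
  fold-↭ f (↭.trans p p′)  = trans (fold-↭ f p) (fold-↭ f p′)

  fold-tabulate : ∀ {n} (h : Fin n → A) f → fold (List.tabulate h) f ≡ sum (f ∘ h)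
  fold-tabulate {n = zero}  h f = ≡.refl
  fold-tabulate {n = suc n} h f = ≡.cong (f (h zero) ∙_) (fold-tabulate (h ∘ suc) f)

  fold-allFin : ∀ n (f : Fin n → Carrier) → fold (allFin n) f ≡ sum f
  fold-allFin n = fold-tabulate id

  foldTo-cong : ∀ n {f g} → (∀ {i} → i < n → f i ≈ g i) → foldTo n f ≈ foldTo n g
  foldTo-cong zero    f≈g = refl
  foldTo-cong (suc n) f≈g = ∙-cong (foldTo-cong n (f≈g ∘ ℕ.m<n⇒m<1+n)) (f≈g (ℕ.n<1+n n))

  foldTo-∙ : ∀ n f g → foldTo n (λ i → f i ∙ g i) ≈ foldTo n f ∙ foldTo n g
  foldTo-∙ zero    f g = sym (identityˡ ε)
  foldTo-∙ (suc n) f g = trans (∙-congʳ (foldTo-∙ n f g)) (interchange _ _ _ _)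

  foldTo-ε : ∀ n → foldTo n (λ _ → ε) ≈ ε
  foldTo-ε zero    = refl
  foldTo-ε (suc n) = trans (identityʳ _) (foldTo-ε n)

  foldTo-head : ∀ n f → foldTo (suc n) f ≈ f 0 ∙ foldTo n (f ∘ suc)
  foldTo-head zero    f = trans (identityˡ _) (sym (identityʳ _))
  foldTo-head (suc n) f = trans (∙-congʳ (foldTo-head n f)) (assoc _ _ _)

  foldTo-reverse : ∀ n f → foldTo (suc n) (λ i → f (n ∸ i)) ≈ foldTo (suc n) f
  foldTo-reverse zero    f = refl
  foldTo-reverse (suc n) f = begin
    foldTo (suc (suc n)) (λ i → f (suc n ∸ i))             ≈⟨ foldTo-head (suc n) _ ⟩
    f (suc n) ∙ foldTo (suc n) (λ i → f (n ∸ i))           ≈⟨ ∙-congˡ (foldTo-reverse n f) ⟩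
    f (suc n) ∙ foldTo (suc n) f                           ≈⟨ comm _ _ ⟩
    foldTo (suc n) f ∙ f (suc n)                           ∎

  sum-toℕ : ∀ n f → sum {n} (f ∘ toℕ) ≈ foldTo n f
  sum-toℕ zero    f = refl
  sum-toℕ (suc n) f = trans (∙-congˡ (sum-toℕ n (f ∘ suc))) (sym (foldTo-head n f))

  fold-applyUpTo : ∀ (h : ℕ → A) n f → fold (applyUpTo h n) f ≈ foldTo n (f ∘ h)
  fold-applyUpTo h zero    f = refl
  fold-applyUpTo h (suc n) f =
    trans (∙-congˡ (fold-applyUpTo (h ∘ suc) n f)) (sym (foldTo-head n (f ∘ h)))

module RingSum (R : CommutativeRing 0ℓ 0ℓ) where
  open CommutativeRing R
  open FiniteSum +-commutativeMonoid

  private variable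
    A : Set

  *-distribˡ-fold : ∀ c (xs : List A) f → c * fold xs f ≈ fold xs (λ x → c * f x)
  *-distribˡ-fold c []       f = zeroʳ c
  *-distribˡ-fold c (x ∷ xs) f = trans (distribˡ _ _ _) (+-congˡ (*-distribˡ-fold c xs f))

  *-distribʳ-fold : ∀ c (xs : List A) f → fold xs f * c ≈ fold xs (λ x → f x * c)
  *-distribʳ-fold c []       f = zeroˡ c
  *-distribʳ-fold c (x ∷ xs) f = trans (distribʳ _ _ _) (+-congˡ (*-distribʳ-fold c xs f))

-- Monoid rings

module MonoidRingProperties
  (R : RawRing 0ℓ 0ℓ)
  (isCommutativeRing : IsCommutativeRing (RawRing._≈_ R) (RawRing._+_ R) (RawRing._*_ R)
                                         (RawRing.-_ R) (RawRing.0# R) (RawRing.1# R))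
  {E : Set} (_∙_ : Op₂ E) (ε : E) (_≟_ : DecidableEquality E)
  (isCommutativeMonoid : IsCommutativeMonoid _≡_ _∙_ ε)
  where

  private
    coefficients : CommutativeRing 0ℓ 0ℓ
    coefficients = record { isCommutativeRing = isCommutativeRing }
    module E = IsCommutativeMonoid isCommutativeMonoid
    module M = RawRing (MonoidRing.rawRing R _∙_ ε _≟_)

  open CommutativeRing coefficients hiding (isCommutativeRing) renaming (-_ to ⊖_)
  open RingProperties ring using (-‿distribˡ-*; -‿+-comm; -0#≈0#)
  open MonoidRing R _∙_ ε _≟_
  open FiniteSum +-commutativeMonoid
  open RingSum coefficients
  open import Relation.Binary.Reasoning.Setoid setoid

  -- The linear extension of g, applied to p.  The coefficients are the
  -- case where g is an indicator, and they determine all the others.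
  ⟨_,_⟩ : M.Carrier → (E → Carrier) → Carrier
  ⟨ p , g ⟩ = fold p (λ (c , d) → c * g d)

  pair-congʳ : ∀ p {g h} → (∀ e → g e ≈ h e) → ⟨ p , g ⟩ ≈ ⟨ p , h ⟩
  pair-congʳ p g≈h = fold-cong p (λ (c , d) → *-congˡ (g≈h d))

  if-*ʳ : ∀ {P : Set} (P? : Dec P) c x → (if does P? then c else 0#) * x ≈ (if does P? then c * x else 0#)
  if-*ʳ P? c x with does P?
  ... | true  = refl
  ... | false = zeroˡ x

  fold-absent : ∀ {L} d (f : E → Carrier) → All (d ≢_) L →
                fold L (λ e → if does (d ≟ e) then f e else 0#) ≈ 0#
  fold-absent {[]}    d f []            = refl
  fold-absent {e ∷ L} d f (d≢e ∷ d∉L) rewrite dec-false (d ≟ e) d≢e =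
    trans (+-identityˡ _) (fold-absent d f d∉L)

  fold-present : ∀ {L} d (f : E → Carrier) → List.Unique L → d ∈ L →
                 fold L (λ e → if does (d ≟ e) then f e else 0#) ≈ f d
  fold-present d f (d∉L ∷ _) (Any.here ≡.refl) rewrite dec-true (d ≟ d) ≡.refl =
    trans (+-congˡ (fold-absent d f d∉L)) (+-identityʳ _)
  fold-present {e ∷ L} d f (e∉L ∷ L!) (Any.there d∈L)
    rewrite dec-false (d ≟ e) (≡.≢-sym (All.lookup e∉L d∈L)) =
    trans (+-identityˡ _) (fold-present d f L! d∈L)

  -- Exchanging the two sums collects the terms of equal exponent. `L` may contain more than the
  -- exponents of `p`, as their coefficients are zero.
  pair-support : ∀ {L} → List.Unique L → ∀ p g → (∀ {t} → t ∈ p → proj₂ t ∈ L) →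
                 ⟨ p , g ⟩ ≈ fold L (λ e → coeff p e * g e)
  pair-support {L} L! p g p⊆L = begin
    ⟨ p , g ⟩
      ≈⟨ fold-cong-∈ p (λ {(c , d)} t∈p → sym (fold-present d (λ e → c * g e) L! (p⊆L t∈p))) ⟩
    fold p (λ (c , d) → fold L (λ e → if does (d ≟ e) then c * g e else 0#))
      ≈⟨ fold-comm p L _ ⟩
    fold L (λ e → fold p (λ (c , d) → if does (d ≟ e) then c * g e else 0#))
      ≈⟨ fold-cong L (λ e → fold-cong p (λ (c , d) → sym (if-*ʳ (d ≟ e) c (g e)))) ⟩
    fold L (λ e → fold p (λ (c , d) → (if does (d ≟ e) then c else 0#) * g e))
      ≈⟨ fold-cong L (λ e → sym (*-distribʳ-fold (g e) p _)) ⟩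
    fold L (λ e → coeff p e * g e) ∎

  -- The exponents of `p` and `r` together, without repetition, form a common support on which the
  -- equal coefficients can be exchanged.
  pair-congˡ : ∀ p r g → p M.≈ r → ⟨ p , g ⟩ ≈ ⟨ r , g ⟩
  pair-congˡ p r g p≈r = begin
    ⟨ p , g ⟩                      ≈⟨ pair-support L! p g (∈-deduplicate⁺ _≟_ ∘ ∈-map⁺ proj₂ ∘ ∈-++⁺ˡ) ⟩
    fold L (λ e → coeff p e * g e) ≈⟨ fold-cong L (λ e → *-congʳ (p≈r e)) ⟩
    fold L (λ e → coeff r e * g e) ≈⟨ pair-support L! r g (∈-deduplicate⁺ _≟_ ∘ ∈-map⁺ proj₂ ∘ ∈-++⁺ʳ p) ⟨
    ⟨ r , g ⟩                      ∎
    where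
    L = deduplicate _≟_ (map proj₂ (p ++ r))
    L! = deduplicate-! _≟_ (map proj₂ (p ++ r))

  coeff-pair : ∀ p e → coeff p e ≈ ⟨ p , (λ d → if does (d ≟ e) then 1# else 0#) ⟩
  coeff-pair p e = fold-cong p (λ (c , d) → lemma (d ≟ e) c)
    where
    lemma : ∀ {P : Set} (P? : Dec P) c →
            (if does P? then c else 0#) ≈ c * (if does P? then 1# else 0#)
    lemma P? c with does P?
    ... | true  = sym (*-identityʳ c)
    ... | false = sym (zeroʳ c)

  -- A coefficient is the pairing with an indicator. Arbitrary `g` are kept because `g (d ∙ d′)` as
  -- a function of `d′` need not be an indicator even when `g` is one.
  pair-injective : ∀ p r → (∀ g → ⟨ p , g ⟩ ≈ ⟨ r , g ⟩) → p M.≈ r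
  pair-injective p r p≈r e = trans (coeff-pair p e) (trans (p≈r _) (sym (coeff-pair r e)))

  pair-* : ∀ p r g → ⟨ p M.* r , g ⟩ ≈ ⟨ p , (λ d → ⟨ r , (λ d′ → g (d ∙ d′)) ⟩) ⟩
  pair-* p r g = trans (fold-product _ p r _) (fold-cong p λ (c , d) →
    trans (fold-cong r (λ _ → *-assoc _ _ _)) (sym (*-distribˡ-fold c r _)))

  pair-comm : ∀ p r (g : E → E → Carrier) →
              ⟨ p , (λ d → ⟨ r , g d ⟩) ⟩ ≈ ⟨ r , (λ d′ → ⟨ p , (λ d → g d d′) ⟩) ⟩
  pair-comm p r g = begin
    fold p (λ (c , d) → c * fold r (λ (c′ , d′) → c′ * g d d′))
      ≈⟨ fold-cong p (λ (c , d) → *-distribˡ-fold c r _) ⟩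
    fold p (λ (c , d) → fold r (λ (c′ , d′) → c * (c′ * g d d′)))
      ≈⟨ fold-comm p r _ ⟩
    fold r (λ (c′ , d′) → fold p (λ (c , d) → c * (c′ * g d d′)))
      ≈⟨ fold-cong r (λ (c′ , d′) → fold-cong p (λ (c , d) → x∙yz≈y∙xz c c′ _)) ⟩
    fold r (λ (c′ , d′) → fold p (λ (c , d) → c′ * (c * g d d′)))
      ≈⟨ fold-cong r (λ (c′ , d′) → *-distribˡ-fold c′ p _) ⟨
    fold r (λ (c′ , d′) → c′ * fold p (λ (c , d) → c * g d d′)) ∎
    where open import Algebra.Properties.CommutativeSemigroup
                        (CommutativeMonoid.commutativeSemigroup *-commutativeMonoid) using (x∙yz≈y∙xz)

  pair-+ʳ : ∀ p g h → ⟨ p , (λ e → g e + h e) ⟩ ≈ ⟨ p , g ⟩ + ⟨ p , h ⟩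
  pair-+ʳ p g h = trans (fold-cong p (λ _ → distribˡ _ _ _)) (fold-∙ p _ _)

  pair-‿- : ∀ p g → ⟨ M.- p , g ⟩ ≈ ⊖ ⟨ p , g ⟩
  pair-‿- []            g = sym -0#≈0#
  pair-‿- ((c , d) ∷ p) g =
    trans (+-cong (sym (-‿distribˡ-* c (g d))) (pair-‿- p g)) (-‿+-comm _ _)

  pair-1 : ∀ g → ⟨ M.1# , g ⟩ ≈ g ε
  pair-1 g = trans (+-identityʳ _) (*-identityˡ _)

  -- Under the pairing, sums become sums in `R` and products become iterated pairings. Each law thus
  -- reduces to laws of `R` and, for associativity, unit and commutativity of the product, to the
  -- same law of `_∙_`.
  monoidRing : CommutativeRing 0ℓ 0ℓ
  monoidRing = record
    { Carrier = M.Carrier ; _≈_ = M._≈_ ; _+_ = M._+_ ; _*_ = M._*_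
    ; -_ = M.-_ ; 0# = M.0# ; 1# = M.1#
    ; isCommutativeRing = record
      { isRing = record
        { +-isAbelianGroup = record
          { isGroup = record
            { isMonoid = record
              { isSemigroup = record
                { isMagma = record
                  { isEquivalence = record
                    { refl = λ _ → refl
                    ; sym = λ p≈r e → sym (p≈r e)
                    ; trans = λ p≈r r≈s e → trans (p≈r e) (r≈s e) }
                  ; ∙-cong = λ {p} {p′} {r} {r′} p≈p′ r≈r′ → pair-injective (p ++ r) (p′ ++ r′) λ g → begin
                      ⟨ p ++ r , g ⟩           ≈⟨ fold-++ p r _ ⟩
                      ⟨ p , g ⟩ + ⟨ r , g ⟩    ≈⟨ +-cong (pair-congˡ p p′ g p≈p′) (pair-congˡ r r′ g r≈r′) ⟩
                      ⟨ p′ , g ⟩ + ⟨ r′ , g ⟩  ≈⟨ fold-++ p′ r′ _ ⟨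
                      ⟨ p′ ++ r′ , g ⟩         ∎ }
                ; assoc = λ p r s → pair-injective ((p ++ r) ++ s) (p ++ (r ++ s)) λ g → begin
                    ⟨ (p ++ r) ++ s , g ⟩                ≈⟨ fold-++ (p ++ r) s _ ⟩
                    ⟨ p ++ r , g ⟩ + ⟨ s , g ⟩           ≈⟨ +-congʳ (fold-++ p r _) ⟩
                    (⟨ p , g ⟩ + ⟨ r , g ⟩) + ⟨ s , g ⟩  ≈⟨ +-assoc _ _ _ ⟩
                    ⟨ p , g ⟩ + (⟨ r , g ⟩ + ⟨ s , g ⟩)  ≈⟨ +-congˡ (fold-++ r s _) ⟨
                    ⟨ p , g ⟩ + ⟨ r ++ s , g ⟩           ≈⟨ fold-++ p (r ++ s) _ ⟨
                    ⟨ p ++ (r ++ s) , g ⟩                ∎ }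
              ; identity = (λ _ _ → refl) , λ p → pair-injective (p ++ []) p λ g →
                  trans (fold-++ p [] _) (+-identityʳ _) }
            ; inverse = (λ p → pair-injective ((M.- p) ++ p) [] λ g →
                  trans (fold-++ (M.- p) p _) (trans (+-congʳ (pair-‿- p g)) (-‿inverseˡ _)))
                , (λ p → pair-injective (p ++ (M.- p)) [] λ g →
                  trans (fold-++ p (M.- p) _) (trans (+-congˡ (pair-‿- p g)) (-‿inverseʳ _)))
            ; ⁻¹-cong = λ {p} {r} p≈r → pair-injective (M.- p) (M.- r) λ g →
                trans (pair-‿- p g) (trans (-‿cong (pair-congˡ p r g p≈r)) (sym (pair-‿- r g))) }
          ; comm = λ p r → pair-injective (p ++ r) (r ++ p) λ g →
              trans (fold-++ p r _) (trans (+-comm _ _) (sym (fold-++ r p _))) }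
        ; *-cong = λ {p} {p′} {r} {r′} p≈p′ r≈r′ → pair-injective (p M.* r) (p′ M.* r′) λ g → begin
            ⟨ p M.* r , g ⟩                                ≈⟨ pair-* p r g ⟩
            ⟨ p , (λ d → ⟨ r , (λ d′ → g (d ∙ d′)) ⟩) ⟩    ≈⟨ pair-congˡ p p′ _ p≈p′ ⟩
            ⟨ p′ , (λ d → ⟨ r , (λ d′ → g (d ∙ d′)) ⟩) ⟩   ≈⟨ pair-congʳ p′ (λ d → pair-congˡ r r′ _ r≈r′) ⟩
            ⟨ p′ , (λ d → ⟨ r′ , (λ d′ → g (d ∙ d′)) ⟩) ⟩  ≈⟨ pair-* p′ r′ g ⟨
            ⟨ p′ M.* r′ , g ⟩                              ∎
        ; *-assoc = λ p r s → pair-injective ((p M.* r) M.* s) (p M.* (r M.* s)) λ g → begin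
            ⟨ (p M.* r) M.* s , g ⟩
              ≈⟨ pair-* (p M.* r) s g ⟩
            ⟨ p M.* r , (λ d → ⟨ s , (λ d″ → g (d ∙ d″)) ⟩) ⟩
              ≈⟨ pair-* p r _ ⟩
            ⟨ p , (λ d → ⟨ r , (λ d′ → ⟨ s , (λ d″ → g ((d ∙ d′) ∙ d″)) ⟩) ⟩) ⟩
              ≈⟨ pair-congʳ p (λ d → pair-congʳ r (λ d′ → pair-congʳ s (λ d″ →
                   reflexive (≡.cong g (E.assoc d d′ d″))))) ⟩
            ⟨ p , (λ d → ⟨ r , (λ d′ → ⟨ s , (λ d″ → g (d ∙ (d′ ∙ d″))) ⟩) ⟩) ⟩
              ≈⟨ pair-congʳ p (λ d → pair-* r s _) ⟨
            ⟨ p , (λ d → ⟨ r M.* s , (λ d′ → g (d ∙ d′)) ⟩) ⟩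
              ≈⟨ pair-* p (r M.* s) g ⟨
            ⟨ p M.* (r M.* s) , g ⟩ ∎
        ; *-identity = (λ p → pair-injective (M.1# M.* p) p λ g →
            trans (pair-* M.1# p g) (trans (pair-1 (λ d → ⟨ p , (λ d′ → g (d ∙ d′)) ⟩))
              (pair-congʳ p (λ d → reflexive (≡.cong g (E.identityˡ d))))))
          , (λ p → pair-injective (p M.* M.1#) p λ g →
            trans (pair-* p M.1# g) (pair-congʳ p (λ d →
              trans (pair-1 (λ d′ → g (d ∙ d′))) (reflexive (≡.cong g (E.identityʳ d))))))
        ; distrib = (λ p r s → pair-injective (p M.* (r ++ s)) (p M.* r ++ p M.* s) λ g → begin
              ⟨ p M.* (r ++ s) , g ⟩
                ≈⟨ pair-* p (r ++ s) g ⟩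
              ⟨ p , (λ d → ⟨ r ++ s , (λ d′ → g (d ∙ d′)) ⟩) ⟩
                ≈⟨ pair-congʳ p (λ d → fold-++ r s _) ⟩
              ⟨ p , (λ d → ⟨ r , (λ d′ → g (d ∙ d′)) ⟩ + ⟨ s , (λ d′ → g (d ∙ d′)) ⟩) ⟩
                ≈⟨ pair-+ʳ p _ _ ⟩
              ⟨ p , (λ d → ⟨ r , (λ d′ → g (d ∙ d′)) ⟩) ⟩ + ⟨ p , (λ d → ⟨ s , (λ d′ → g (d ∙ d′)) ⟩) ⟩
                ≈⟨ +-cong (pair-* p r g) (pair-* p s g) ⟨
              ⟨ p M.* r , g ⟩ + ⟨ p M.* s , g ⟩
                ≈⟨ fold-++ (p M.* r) (p M.* s) _ ⟨
              ⟨ p M.* r ++ p M.* s , g ⟩ ∎)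
          , (λ p r s → pair-injective ((r ++ s) M.* p) (r M.* p ++ s M.* p) λ g → begin
              ⟨ (r ++ s) M.* p , g ⟩
                ≈⟨ pair-* (r ++ s) p g ⟩
              ⟨ r ++ s , (λ d → ⟨ p , (λ d′ → g (d ∙ d′)) ⟩) ⟩
                ≈⟨ fold-++ r s _ ⟩
              ⟨ r , (λ d → ⟨ p , (λ d′ → g (d ∙ d′)) ⟩) ⟩ + ⟨ s , (λ d → ⟨ p , (λ d′ → g (d ∙ d′)) ⟩) ⟩
                ≈⟨ +-cong (pair-* r p g) (pair-* s p g) ⟨
              ⟨ r M.* p , g ⟩ + ⟨ s M.* p , g ⟩
                ≈⟨ fold-++ (r M.* p) (s M.* p) _ ⟨
              ⟨ r M.* p ++ s M.* p , g ⟩ ∎) }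
      ; *-comm = λ p r → pair-injective (p M.* r) (r M.* p) λ g → begin
          ⟨ p M.* r , g ⟩
            ≈⟨ pair-* p r g ⟩
          ⟨ p , (λ d → ⟨ r , (λ d′ → g (d ∙ d′)) ⟩) ⟩
            ≈⟨ pair-comm p r _ ⟩
          ⟨ r , (λ d′ → ⟨ p , (λ d → g (d ∙ d′)) ⟩) ⟩
            ≈⟨ pair-congʳ r (λ d′ → pair-congʳ p (λ d → reflexive (≡.cong g (E.comm d d′)))) ⟩
          ⟨ r , (λ d′ → ⟨ p , (λ d → g (d′ ∙ d)) ⟩) ⟩
            ≈⟨ pair-* r p g ⟨
          ⟨ r M.* p , g ⟩ ∎ } }

  monomial-cong : ∀ {c c′} d → c ≈ c′ → monomial c d M.≈ monomial c′ d
  monomial-cong d c≈c′ = pair-injective (monomial _ d) (monomial _ d) λ g → +-congʳ (*-congʳ c≈c′)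

  monomial-0 : ∀ d → monomial 0# d M.≈ M.0#
  monomial-0 d = pair-injective (monomial 0# d) [] λ g → trans (+-identityʳ _) (zeroˡ _)

  monomial-+ : ∀ c c′ d → monomial (c + c′) d M.≈ monomial c d M.+ monomial c′ d
  monomial-+ c c′ d = pair-injective (monomial (c + c′) d) (monomial c d ++ monomial c′ d) λ g →
    trans (+-congʳ (distribʳ (g d) c c′)) (+-assoc _ _ _)

-- Sums over Lehmer codes

select : {A : Set} → ℕ → (ℕ → A) → (ℕ → A) → ℕ → A
select c a b i = if i <ᵇ c then a i else b i

select-< : ∀ {A : Set} {c i} (a b : ℕ → A) → i < c → select c a b i ≡ a i
select-< {i = zero}  a b (s≤s _)   = ≡.refl
select-< {i = suc i} a b (s≤s i<c) = select-< (a ∘ suc) (b ∘ suc) i<c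

select-≥ : ∀ {A : Set} {c i} (a b : ℕ → A) → c ≤ i → select c a b i ≡ b i
select-≥ {c = zero}              a b z≤n       = ≡.refl
select-≥ {c = suc c} {i = suc i} a b (s≤s c≤i) = select-≥ (a ∘ suc) (b ∘ suc) c≤i

-- The two laws of `Q` make its values the integer powers of a unit, so negative exponents of q are
-- available without division.
record LaurentAlgebra : Set₁ where
  field
    commutativeRing : CommutativeRing 0ℓ 0ℓ
  open CommutativeRing commutativeRing public hiding (-_; zero)
  field
    Q   : ℤ → Carrier
    Q-+ : ∀ a b → Q (a ℤ.+ b) ≈ Q a * Q b
    Q-0 : Q (+ 0) ≈ 1#
    z   : Carrier

module Recurrences (𝓐 : LaurentAlgebra) where

  open LaurentAlgebra 𝓐
  open RingProperties ring using (+-cancelʳ)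
  open SemiringSolver commutativeSemiring using (solve; _:=_; _:+_; _:*_; con)
  open import Relation.Binary.Reasoning.Setoid setoid
  open FiniteSum +-commutativeMonoid
  module Π = FiniteSum *-commutativeMonoid

  q : Carrier
  q = Q (+ 1)

  q^-suc : ∀ n → Q (+ suc n) ≈ q * Q (+ n)
  q^-suc n = Q-+ (+ 1) (+ n)

  q^-inverse : ∀ n → Q (+ n) * Q (- (+ n)) ≈ 1#
  q^-inverse n = begin
    Q (+ n) * Q (- (+ n))   ≈⟨ Q-+ (+ n) (- (+ n)) ⟨
    Q (+ n ℤ.+ - (+ n))     ≡⟨ ≡.cong Q (ℤ.+-inverseʳ (+ n)) ⟩
    Q (+ 0)                 ≈⟨ Q-0 ⟩
    1#                      ∎

  *-distribˡ-foldTo : ∀ c n f → c * foldTo n f ≈ foldTo n (λ i → c * f i)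
  *-distribˡ-foldTo c zero    f = zeroʳ c
  *-distribˡ-foldTo c (suc n) f = trans (distribˡ _ _ _) (+-congʳ (*-distribˡ-foldTo c n f))

  foldTo-comm : ∀ m n (f : ℕ → ℕ → Carrier) →
                foldTo m (λ i → foldTo n (f i)) ≈ foldTo n (λ j → foldTo m (λ i → f i j))
  foldTo-comm zero    n f = sym (foldTo-ε n)
  foldTo-comm (suc m) n f = trans (+-congʳ (foldTo-comm m n f)) (sym (foldTo-∙ n _ (f m)))

  foldTo-select : ∀ n a b → foldTo n (select n a b) ≈ foldTo n a
  foldTo-select n a b = foldTo-cong n (λ i<n → reflexive (select-< a b i<n))

  -- The two selections differ only at index `c`. Each side is completed by the entry that the other
  -- one selects there, which avoids subtraction.
  foldTo-select-suc : ∀ {n} c a b → c < n →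
    foldTo n (select (suc c) a b) + b c ≈ foldTo n (select c a b) + a c
  foldTo-select-suc {suc n} c a b (s≤s c≤n) with ℕ.m≤n⇒m<n∨m≡n c≤n
  ... | inj₁ c<n = begin
    (foldTo n (select (suc c) a b) + select (suc c) a b n) + b c
      ≈⟨ +-congʳ (+-congˡ (reflexive (select-≥ a b c<n))) ⟩
    (foldTo n (select (suc c) a b) + b n) + b c
      ≈⟨ swap _ _ _ ⟩
    (foldTo n (select (suc c) a b) + b c) + b n
      ≈⟨ +-congʳ (foldTo-select-suc c a b c<n) ⟩
    (foldTo n (select c a b) + a c) + b n
      ≈⟨ swap _ _ _ ⟩
    (foldTo n (select c a b) + b n) + a c
      ≈⟨ +-congʳ (+-congˡ (reflexive (select-≥ a b c≤n))) ⟨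
    (foldTo n (select c a b) + select c a b n) + a c ∎
    where
    swap : ∀ x y w → (x + y) + w ≈ (x + w) + y
    swap = solve 3 (λ x y w → (x :+ y) :+ w := (x :+ w) :+ y) refl
  ... | inj₂ ≡.refl = begin
    (foldTo c (select (suc c) a b) + select (suc c) a b c) + b c
      ≈⟨ +-congʳ (+-cong (foldTo-cong c λ i<c → reflexive (≡.trans
           (select-< a b (ℕ.m<n⇒m<1+n i<c)) (≡.sym (select-< a b i<c))))
           (reflexive (select-< a b (ℕ.n<1+n c)))) ⟩
    (foldTo c (select c a b) + a c) + b c
      ≈⟨ solve 3 (λ x y w → (x :+ y) :+ w := (x :+ w) :+ y) refl _ _ _ ⟩
    (foldTo c (select c a b) + b c) + a c
      ≈⟨ +-congʳ (+-congˡ (reflexive (select-≥ a b ℕ.≤-refl))) ⟨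
    (foldTo c (select c a b) + select c a b c) + a c ∎

  -- K(n, c) of the introduction.  codeDes, codeAsc and codeMaj 0 below compute
  -- the three sums restricted to last code entry c; values with c > n are junk.
  codeSum : ℕ → ℕ → Carrier
  codeSum zero    c       = 1#
  codeSum (suc n) zero    = foldTo (suc n) (codeSum n)
  codeSum (suc n) (suc c) = q * codeSum (suc n) c + z * codeSum n c

  -- The recurrences stay inside the triangle `c ≤ n` and determine it. This is applied to
  -- `codeDes`, to `codeMaj 0` and to the values of the functional `L`.
  codeSum-unique : (D : ℕ → ℕ → Carrier) → D 0 0 ≈ 1# →
             (∀ n → D (suc n) 0 ≈ foldTo (suc n) (D n)) →
             (∀ n c → c ≤ n → D (suc n) (suc c) ≈ q * D (suc n) c + z * D n c) →
             ∀ n c → c ≤ n → D n c ≈ codeSum n c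
  codeSum-unique D D₀ D-zero D-suc zero    zero    _         = D₀
  codeSum-unique D D₀ D-zero D-suc (suc n) zero    _         = trans (D-zero n)
    (foldTo-cong (suc n) λ { (s≤s c≤n) → codeSum-unique D D₀ D-zero D-suc n _ c≤n })
  codeSum-unique D D₀ D-zero D-suc (suc n) (suc c) (s≤s c≤n) = trans (D-suc n c c≤n) (+-cong
    (*-congˡ (codeSum-unique D D₀ D-zero D-suc (suc n) c (ℕ.m≤n⇒m≤1+n c≤n)))
    (*-congˡ (codeSum-unique D D₀ D-zero D-suc n c c≤n)))

  -- The quotient z/q^s.
  ζ : ℕ → Carrier
  ζ s = Q (- (+ s)) * z

  q^*ζ : ∀ s → Q (+ s) * ζ s ≈ z
  q^*ζ s = trans (sym (*-assoc _ _ _)) (trans (*-congʳ (q^-inverse s)) (*-identityˡ z))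

  -- Descents weighted by inv.

  codeDes : ℕ → ℕ → Carrier
  codeDes zero    c = 1#
  codeDes (suc n) c = Q (+ c) * foldTo (suc n) (select c (λ c′ → codeDes n c′ * (1# + ζ (suc c′))) (codeDes n))

  -- The higher threshold adds only the summand `codeDes n c * ζ (suc c)`, and the prefactor q^{c+1}
  -- cancels the denominator of `ζ (suc c)`.
  codeDes-suc : ∀ n c → c ≤ n → codeDes (suc n) (suc c) ≈ q * codeDes (suc n) c + z * codeDes n c
  codeDes-suc n c c≤n = begin
    Q (+ suc c) * S′                                     ≈⟨ *-congˡ S′≈ ⟩
    Q (+ suc c) * (S + d * ζ (suc c))                    ≈⟨ solve 4 (λ x y d t → x :* (y :+ d :* t) := x :* y :+ d :* (x :* t)) refl _ _ _ _ ⟩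
    Q (+ suc c) * S + d * (Q (+ suc c) * ζ (suc c))      ≈⟨ +-cong (*-congʳ (q^-suc c)) (*-congˡ (q^*ζ (suc c))) ⟩
    (q * Q (+ c)) * S + d * z                            ≈⟨ +-cong (*-assoc _ _ _) (*-comm _ _) ⟩
    q * (Q (+ c) * S) + z * d                            ∎
    where
    d = codeDes n c
    a = λ c′ → codeDes n c′ * (1# + ζ (suc c′))
    S = foldTo (suc n) (select c a (codeDes n))
    S′ = foldTo (suc n) (select (suc c) a (codeDes n))
    S′≈ : S′ ≈ S + d * ζ (suc c)
    S′≈ = +-cancelʳ d _ _ (trans (foldTo-select-suc c a (codeDes n) (s≤s c≤n))
      (solve 3 (λ x d t → x :+ d :* (con 1 :+ t) := (x :+ d :* t) :+ d) refl S d (ζ (suc c))))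

  codeDes≈codeSum : ∀ n c → c ≤ n → codeDes n c ≈ codeSum n c
  codeDes≈codeSum = codeSum-unique codeDes refl (λ n → trans (*-congʳ Q-0) (*-identityˡ _)) codeDes-suc

  -- Ascents weighted by inv.

  codeAsc : ℕ → ℕ → Carrier
  codeAsc zero    c = 1#
  codeAsc (suc n) c = Q (+ c) * foldTo (suc n) (select c (codeAsc n) (λ c′ → codeAsc n c′ * (1# + ζ c)))

  codeAsc-tail : ℕ → ℕ → Carrier
  codeAsc-tail n c = foldTo (suc n) (select c (λ _ → 0#) (codeAsc n))

  codeAsc-tail-suc : ∀ n c → c ≤ n → codeAsc-tail n c ≈ codeAsc n c + codeAsc-tail n (suc c)
  codeAsc-tail-suc n c c≤n = trans (sym (+-identityʳ _))
    (trans (sym (foldTo-select-suc c (λ _ → 0#) (codeAsc n) (s≤s c≤n))) (+-comm _ _))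

  -- The factor `1# + ζ c` is the same for all previous entries from `c` upward, so its second part
  -- collects into a single tail sum, and q^c cancels against `ζ c`.
  codeAsc-suc : ∀ n c → codeAsc (suc n) c ≈ Q (+ c) * foldTo (suc n) (codeAsc n) + z * codeAsc-tail n c
  codeAsc-suc n c = begin
    Q (+ c) * foldTo (suc n) (select c (codeAsc n) (λ c′ → codeAsc n c′ * (1# + ζ c)))
      ≈⟨ *-congˡ (foldTo-cong (suc n) (λ {i} _ → split i)) ⟩
    Q (+ c) * foldTo (suc n) (λ i → codeAsc n i + ζ c * select c (λ _ → 0#) (codeAsc n) i)
      ≈⟨ *-congˡ (foldTo-∙ (suc n) _ _) ⟩
    Q (+ c) * (foldTo (suc n) (codeAsc n) + foldTo (suc n) (λ i → ζ c * select c (λ _ → 0#) (codeAsc n) i))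
      ≈⟨ *-congˡ (+-congˡ (*-distribˡ-foldTo (ζ c) (suc n) _)) ⟨
    Q (+ c) * (foldTo (suc n) (codeAsc n) + ζ c * codeAsc-tail n c)
      ≈⟨ solve 4 (λ x f t v → x :* (f :+ t :* v) := x :* f :+ (x :* t) :* v) refl _ _ _ _ ⟩
    Q (+ c) * foldTo (suc n) (codeAsc n) + (Q (+ c) * ζ c) * codeAsc-tail n c
      ≈⟨ +-congˡ (*-congʳ (q^*ζ c)) ⟩
    Q (+ c) * foldTo (suc n) (codeAsc n) + z * codeAsc-tail n c ∎
    where
    split : ∀ i → select c (codeAsc n) (λ c′ → codeAsc n c′ * (1# + ζ c)) i
                  ≈ codeAsc n i + ζ c * select c (λ _ → 0#) (codeAsc n) i
    split i with i <ᵇ c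
    ... | true  = solve 2 (λ u t → u := u :+ t :* con 0) refl _ _
    ... | false = solve 2 (λ u t → u :* (con 1 :+ t) := u :+ t :* u) refl _ _

  -- Induction on the number `r` of entries from `c` upward. Peeling off the entry `c` leaves tails
  -- with one entry fewer, at `suc n` from `suc c` and at `n` from `c`, together with the full sum
  -- at `n`.
  codeAsc-tail≈codeSum : ∀ n c r → c ℕ.+ r ≡ suc n → codeAsc-tail n c ≈ Q (+ c) * foldTo r (codeSum n)
  codeAsc-tail≈codeSum n c zero c+r≡1+n = begin
    codeAsc-tail n c                      ≈⟨ foldTo-cong (suc n) (λ i<1+n → reflexive
                                         (select-< _ (codeAsc n) (≡.subst (_ ≤_) 1+n≡c i<1+n))) ⟩
    foldTo (suc n) (λ _ → 0#)       ≈⟨ foldTo-ε (suc n) ⟩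
    0#                              ≈⟨ zeroʳ _ ⟨
    Q (+ c) * 0#                    ∎
    where
    1+n≡c : suc n ≡ c
    1+n≡c = ≡.trans (≡.sym c+r≡1+n) (ℕ.+-identityʳ c)
  codeAsc-tail≈codeSum zero zero (suc zero) c+r≡1+n = sym (trans (*-congʳ Q-0) (*-identityˡ _))
  codeAsc-tail≈codeSum zero (suc zero)    (suc r) ()
  codeAsc-tail≈codeSum zero (suc (suc c)) (suc r) ()
  codeAsc-tail≈codeSum (suc n) c (suc r) c+r≡2+n = begin
    codeAsc-tail (suc n) c
      ≈⟨ codeAsc-tail-suc (suc n) c c≤1+n ⟩
    codeAsc (suc n) c + codeAsc-tail (suc n) (suc c)
      ≈⟨ +-cong (codeAsc-suc n c) (codeAsc-tail≈codeSum (suc n) (suc c) r (≡.cong suc c+r≡1+n)) ⟩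
    (Q (+ c) * foldTo (suc n) (codeAsc n) + z * codeAsc-tail n c) + Q (+ suc c) * foldTo r (codeSum (suc n))
      ≈⟨ +-cong (+-cong (*-congˡ total) (*-congˡ (codeAsc-tail≈codeSum n c r c+r≡1+n))) (*-congʳ (q^-suc c)) ⟩
    (Q (+ c) * codeSum (suc n) 0 + z * (Q (+ c) * foldTo r (codeSum n))) + (q * Q (+ c)) * foldTo r (codeSum (suc n))
      -- With q^c factored out, the two sums over i < r merge by the recurrence into the values
      -- K(n+1, i+1), and K(n+1, 0) supplies the missing first term.
      ≈⟨ solve 6 (λ x f z k q k′ → (x :* f :+ z :* (x :* k)) :+ (q :* x) :* k′
                                   := x :* (f :+ (q :* k′ :+ z :* k))) refl _ _ _ _ _ _ ⟩
    Q (+ c) * (codeSum (suc n) 0 + (q * foldTo r (codeSum (suc n)) + z * foldTo r (codeSum n)))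
      ≈⟨ *-congˡ (+-congˡ (+-cong (*-distribˡ-foldTo q r _) (*-distribˡ-foldTo z r _))) ⟩
    Q (+ c) * (codeSum (suc n) 0 + (foldTo r (λ i → q * codeSum (suc n) i) + foldTo r (λ i → z * codeSum n i)))
      ≈⟨ *-congˡ (+-congˡ (foldTo-∙ r _ _)) ⟨
    Q (+ c) * (codeSum (suc n) 0 + foldTo r (λ i → codeSum (suc n) (suc i)))
      ≈⟨ *-congˡ (foldTo-head r (codeSum (suc n))) ⟨
    Q (+ c) * foldTo (suc r) (codeSum (suc n)) ∎
    where
    c+r≡1+n : c ℕ.+ r ≡ suc n
    c+r≡1+n = ℕ.suc-injective (≡.trans (≡.sym (ℕ.+-suc c r)) c+r≡2+n)
    c≤1+n : c ≤ suc n
    c≤1+n = ≡.subst (c ≤_) c+r≡1+n (ℕ.m≤m+n c r)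
    total : foldTo (suc n) (codeAsc n) ≈ codeSum (suc n) 0
    total = trans (codeAsc-tail≈codeSum n 0 (suc n) ≡.refl) (trans (*-congʳ Q-0) (*-identityˡ _))

  ∑codeAsc≈∑codeSum : ∀ n → foldTo (suc n) (codeAsc n) ≈ foldTo (suc n) (codeSum n)
  ∑codeAsc≈∑codeSum n = trans (codeAsc-tail≈codeSum n 0 (suc n) ≡.refl) (trans (*-congʳ Q-0) (*-identityˡ _))

  -- Descents weighted by maj.

  ζ! : ℕ → Carrier
  ζ! s = Π.foldTo s (λ j → 1# + ζ (suc j))

  -- The product over j ≤ des is replaced by j ≤ s + des, so that a descent
  -- created by appending a letter amounts to increasing s.
  codeMaj : ℕ → ℕ → ℕ → Carrier
  codeMaj s zero    c = ζ! s
  codeMaj s (suc n) c = foldTo (suc n) (select c (λ c′ → Q (+ suc n) * codeMaj (suc s) n c′) (codeMaj s n))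

  q*ζ : ∀ s → q * ζ (suc s) ≈ ζ s
  q*ζ s = begin
    q * (Q (- (+ suc s)) * z)   ≈⟨ *-assoc _ _ _ ⟨
    (q * Q (- (+ suc s))) * z   ≈⟨ *-congʳ (Q-+ (+ 1) (- (+ suc s))) ⟨
    Q (+ 1 ℤ.+ - (+ suc s)) * z ≡⟨ ≡.cong (λ i → Q i * z) (1-[1+s] s) ⟩
    Q (- (+ s)) * z             ∎
    where
    1-[1+s] : ∀ s → + 1 ℤ.+ - (+ suc s) ≡ - (+ s)
    1-[1+s] zero    = ≡.refl
    1-[1+s] (suc s) = ≡.refl

  codeMaj-suc : ∀ s n c → c ≤ n →
          codeMaj s (suc n) (suc c) + codeMaj s n c ≈ codeMaj s (suc n) c + Q (+ suc n) * codeMaj (suc s) n c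
  codeMaj-suc s n c c≤n = foldTo-select-suc c _ (codeMaj s n) (s≤s c≤n)

  -- (q - 1) M_s(n+1,c) = qⁿ⁺¹ M_{s+1}(n,c) - (1 + z/qˢ) M_s(n,c), with both
  -- sides moved so that no subtraction occurs.
  codeMaj-shift : ∀ s n c → c ≤ n →
            q * codeMaj s (suc n) c + (1# + ζ s) * codeMaj s n c ≈ Q (+ suc n) * codeMaj (suc s) n c + codeMaj s (suc n) c

  -- The definition gives the difference of neighbouring columns in terms of `suc s`;
  -- `codeMaj-shift` trades that term for ones with `s` alone. At `s = 0` the factor `ζ s` is `z`,
  -- which yields the recurrence of `codeSum`.
  codeMaj-step : ∀ s n c → c ≤ n → codeMaj s (suc n) (suc c) ≈ q * codeMaj s (suc n) c + ζ s * codeMaj s n c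
  codeMaj-step s n c c≤n = +-cancelʳ (codeMaj s n c) _ _ (begin
    codeMaj s (suc n) (suc c) + codeMaj s n c                        ≈⟨ codeMaj-suc s n c c≤n ⟩
    codeMaj s (suc n) c + Q (+ suc n) * codeMaj (suc s) n c          ≈⟨ +-comm _ _ ⟩
    Q (+ suc n) * codeMaj (suc s) n c + codeMaj s (suc n) c          ≈⟨ codeMaj-shift s n c c≤n ⟨
    q * codeMaj s (suc n) c + (1# + ζ s) * codeMaj s n c
      ≈⟨ solve 3 (λ x t m → x :+ (con 1 :+ t) :* m := (x :+ t :* m) :+ m) refl _ _ _ ⟩
    (q * codeMaj s (suc n) c + ζ s * codeMaj s n c) + codeMaj s n c        ∎)

  codeMaj-shift s zero zero z≤n = begin
    q * (0# + ζ! s) + (1# + ζ s) * ζ! s         ≈⟨ +-congˡ (*-congʳ (+-congˡ (q*ζ s))) ⟨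
    q * (0# + ζ! s) + (1# + q * ζ (suc s)) * ζ! s
      ≈⟨ solve 3 (λ q t x → q :* (con 0 :+ x) :+ (con 1 :+ q :* t) :* x
                            := q :* (x :* (con 1 :+ t)) :+ (con 0 :+ x)) refl _ _ _ ⟩
    q * (ζ! s * (1# + ζ (suc s))) + (0# + ζ! s) ∎
  codeMaj-shift s (suc n) zero z≤n = begin
    q * (S + T) + (1# + ζ s) * F            ≈⟨ +-congʳ (*-congˡ (+-congˡ last)) ⟩
    q * (S + qⁿ⁺¹ * F′) + (1# + ζ s) * F
      ≈⟨ solve 5 (λ q S u t F → q :* (S :+ u) :+ t :* F := (q :* S :+ t :* F) :+ q :* u) refl _ _ _ _ _ ⟩
    (q * S + (1# + ζ s) * F) + q * (qⁿ⁺¹ * F′) ≈⟨ +-congʳ summed ⟩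
    (qⁿ⁺¹ * F′ + S) + q * (qⁿ⁺¹ * F′)
      ≈⟨ solve 4 (λ x f S q → (x :* f :+ S) :+ q :* (x :* f) := (q :* x) :* f :+ (S :+ x :* f)) refl _ _ _ _ ⟩
    (q * qⁿ⁺¹) * F′ + (S + qⁿ⁺¹ * F′)            ≈⟨ +-cong (*-congʳ (q^-suc (suc n))) (+-congˡ last) ⟨
    Q (+ suc (suc n)) * F′ + (S + T)         ∎
    where
    qⁿ⁺¹ = Q (+ suc n)
    S = foldTo (suc n) (codeMaj s (suc n))
    T = codeMaj s (suc n) (suc n)
    F = foldTo (suc n) (codeMaj s n)
    F′ = foldTo (suc n) (codeMaj (suc s) n)
    -- The entry `suc n` exceeds every possible previous entry, so the last position is always a
    -- descent.
    last : T ≈ qⁿ⁺¹ * F′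
    last = trans (foldTo-select (suc n) _ _) (sym (*-distribˡ-foldTo qⁿ⁺¹ (suc n) _))
    -- Column zero is a sum over all previous entries, so its identity comes from adding up the
    -- identities for `n`.
    summed : q * S + (1# + ζ s) * F ≈ qⁿ⁺¹ * F′ + S
    summed = begin
      q * S + (1# + ζ s) * F
        ≈⟨ +-cong (*-distribˡ-foldTo _ (suc n) _) (*-distribˡ-foldTo _ (suc n) _) ⟩
      foldTo (suc n) (λ c → q * codeMaj s (suc n) c) + foldTo (suc n) (λ c → (1# + ζ s) * codeMaj s n c)
        ≈⟨ foldTo-∙ (suc n) _ _ ⟨
      foldTo (suc n) (λ c → q * codeMaj s (suc n) c + (1# + ζ s) * codeMaj s n c)
        ≈⟨ foldTo-cong (suc n) (λ { (s≤s c≤n) → codeMaj-shift s n _ c≤n }) ⟩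
      foldTo (suc n) (λ c → qⁿ⁺¹ * codeMaj (suc s) n c + codeMaj s (suc n) c)
        ≈⟨ foldTo-∙ (suc n) _ _ ⟩
      foldTo (suc n) (λ c → qⁿ⁺¹ * codeMaj (suc s) n c) + S
        ≈⟨ +-congʳ (*-distribˡ-foldTo qⁿ⁺¹ (suc n) _) ⟨
      qⁿ⁺¹ * F′ + S ∎
  codeMaj-shift s (suc n) (suc c) (s≤s c≤n) = begin
    q * codeMaj s (suc (suc n)) (suc c) + (1# + ζ s) * codeMaj s (suc n) (suc c)
      ≈⟨ +-cong (*-congˡ (codeMaj-step s (suc n) c c≤1+n)) (*-congˡ (codeMaj-step s n c c≤n)) ⟩
    q * (q * x + ζ s * y) + (1# + ζ s) * (q * y + ζ s * w)
      -- `codeMaj-step` is linear with coefficients `q` and `ζ s` that do not depend on `n` or `c`,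
      -- so the same combination of two earlier instances of the shift identity appears.
      ≈⟨ solve 5 (λ q t x y w → q :* (q :* x :+ t :* y) :+ (con 1 :+ t) :* (q :* y :+ t :* w)
            := q :* (q :* x :+ (con 1 :+ t) :* y) :+ t :* (q :* y :+ (con 1 :+ t) :* w)) refl _ _ _ _ _ ⟩
    q * (q * x + (1# + ζ s) * y) + ζ s * (q * y + (1# + ζ s) * w)
      ≈⟨ +-cong (*-congˡ (codeMaj-shift s (suc n) c c≤1+n)) (*-congˡ (codeMaj-shift s n c c≤n)) ⟩
    q * (qⁿ⁺² * y′ + x) + ζ s * (qⁿ⁺¹ * w′ + y)
      ≈⟨ solve 8 (λ q a y′ x t b w′ y → q :* (a :* y′ :+ x) :+ t :* (b :* w′ :+ y)
            := (a :* (q :* y′) :+ (t :* b) :* w′) :+ (q :* x :+ t :* y)) refl _ _ _ _ _ _ _ _ ⟩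
    (qⁿ⁺² * (q * y′) + (ζ s * qⁿ⁺¹) * w′) + (q * x + ζ s * y)
      -- The terms with `suc s` must recombine by `codeMaj-step (suc s)`, whose coefficient is
      -- `ζ (suc s)`: passing to it from `ζ s` costs one factor `q`, which turns q^{n+1} into
      -- q^{n+2}.
      ≈⟨ +-cong (+-congˡ (*-congʳ shift)) (sym (codeMaj-step s (suc n) c c≤1+n)) ⟩
    (qⁿ⁺² * (q * y′) + (qⁿ⁺² * ζ (suc s)) * w′) + codeMaj s (suc (suc n)) (suc c)
      ≈⟨ +-congʳ (solve 4 (λ a y t w → a :* y :+ (a :* t) :* w := a :* (y :+ t :* w)) refl _ _ _ _) ⟩
    qⁿ⁺² * (q * y′ + ζ (suc s) * w′) + codeMaj s (suc (suc n)) (suc c)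
      ≈⟨ +-congʳ (*-congˡ (codeMaj-step (suc s) n c c≤n)) ⟨
    qⁿ⁺² * codeMaj (suc s) (suc n) (suc c) + codeMaj s (suc (suc n)) (suc c) ∎
    where
    c≤1+n = ℕ.m≤n⇒m≤1+n c≤n
    qⁿ⁺¹ = Q (+ suc n)
    qⁿ⁺² = Q (+ suc (suc n))
    x = codeMaj s (suc (suc n)) c
    y = codeMaj s (suc n) c
    w = codeMaj s n c
    y′ = codeMaj (suc s) (suc n) c
    w′ = codeMaj (suc s) n c
    shift : ζ s * qⁿ⁺¹ ≈ qⁿ⁺² * ζ (suc s)
    shift = begin
      ζ s * qⁿ⁺¹                 ≈⟨ *-congʳ (q*ζ s) ⟨
      (q * ζ (suc s)) * qⁿ⁺¹     ≈⟨ solve 3 (λ q t x → (q :* t) :* x := (q :* x) :* t) refl _ _ _ ⟩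
      (q * qⁿ⁺¹) * ζ (suc s)     ≈⟨ *-congʳ (q^-suc (suc n)) ⟨
      qⁿ⁺² * ζ (suc s)          ∎

  codeMaj≈codeSum : ∀ n c → c ≤ n → codeMaj 0 n c ≈ codeSum n c
  codeMaj≈codeSum = codeSum-unique (codeMaj 0) refl (λ n → refl) λ n c c≤n →
    trans (codeMaj-step 0 n c c≤n) (+-congˡ (*-congʳ (trans (*-congʳ Q-0) (*-identityˡ z))))

  -- Umbral evaluation of the total.

  qnum : ℕ → Carrier
  qnum k = foldTo k (λ i → Q (+ i))

  qnum-suc : ∀ k → qnum (suc k) ≈ 1# + q * qnum k
  qnum-suc k = begin
    qnum (suc k)                            ≈⟨ foldTo-head k _ ⟩
    Q (+ 0) + foldTo k (λ i → Q (+ suc i))  ≈⟨ +-cong Q-0 (foldTo-cong k (λ {i} _ → q^-suc i)) ⟩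
    1# + foldTo k (λ i → q * Q (+ i))       ≈⟨ +-congˡ (*-distribˡ-foldTo q k _) ⟨
    1# + q * qnum k                         ∎

  qfact : ℕ → Carrier
  qfact k = Π.foldTo k (qnum ∘ suc)

  Seq : Set
  Seq = ℕ → Carrier

  -- Sequences are coordinates in the basis P_k = ∏_{i<k} (x - z[i]) of
  -- polynomials in x.  In these coordinates X is multiplication by x, Y is
  -- multiplication by q x + z, and ∂ is the divided difference
  -- f ↦ (f(x) - f(q x + z)) / (x - (q x + z)), which maps P_k to [k] P_{k-1}.
  -- L is a truncation of the linear functional P_k ↦ [k]!, and L ∘ ∂ agrees
  -- with L on multiples of x.
  X Y ∂ : Seq → Seq
  X v zero    = 0#
  X v (suc k) = v k + z * (qnum (suc k) * v (suc k))
  Y v k = q * X v k + z * v k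
  ∂ v k = qnum (suc k) * v (suc k)

  L : ℕ → Seq → Carrier
  L N v = foldTo (suc N) (λ k → qfact k * v k)

  X-cong : ∀ {v w} → (∀ k → v k ≈ w k) → ∀ k → X v k ≈ X w k
  X-cong v≈w zero    = refl
  X-cong v≈w (suc k) = +-cong (v≈w k) (*-congˡ (*-congˡ (v≈w (suc k))))

  Y-cong : ∀ {v w} → (∀ k → v k ≈ w k) → ∀ k → Y v k ≈ Y w k
  Y-cong v≈w k = +-cong (*-congˡ (X-cong v≈w k)) (*-congˡ (v≈w k))

  L-cong : ∀ N {v w} → (∀ k → v k ≈ w k) → L N v ≈ L N w
  L-cong N v≈w = foldTo-cong (suc N) (λ {k} _ → *-congˡ (v≈w k))

  XY≈YX : ∀ v k → X (Y v) k ≈ Y (X v) k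
  XY≈YX v zero    = solve 2 (λ q z → con 0 := q :* con 0 :+ z :* con 0) refl q z
  XY≈YX v (suc k) = solve 7
    (λ q z b x v₀ v₁ x₁ → (q :* x :+ z :* v₀) :+ z :* (b :* (q :* x₁ :+ z :* v₁))
       := q :* (x :+ z :* (b :* x₁)) :+ z :* (v₀ :+ z :* (b :* v₁)))
    refl q z (qnum (suc k)) (X v k) (v k) (v (suc k)) (X v (suc k))

  Y-+ : ∀ v w k → Y (λ k → v k + w k) k ≈ Y v k + Y w k
  Y-+ v w zero    = solve 4 (λ q z a b → q :* con 0 :+ z :* (a :+ b)
    := (q :* con 0 :+ z :* a) :+ (q :* con 0 :+ z :* b)) refl q z (v 0) (w 0)
  Y-+ v w (suc k) = solve 7
    (λ q z b v₀ v₁ w₀ w₁ → q :* ((v₀ :+ w₀) :+ z :* (b :* (v₁ :+ w₁))) :+ z :* (v₁ :+ w₁)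
       := (q :* (v₀ :+ z :* (b :* v₁)) :+ z :* v₁) :+ (q :* (w₀ :+ z :* (b :* w₁)) :+ z :* w₁))
    refl q z (qnum (suc k)) (v k) (v (suc k)) (w k) (w (suc k))

  Y-0 : ∀ k → Y (λ _ → 0#) k ≈ 0#
  Y-0 zero    = solve 2 (λ q z → q :* con 0 :+ z :* con 0 := con 0) refl q z
  Y-0 (suc k) = solve 3 (λ q z b → q :* (con 0 :+ z :* (b :* con 0)) :+ z :* con 0 := con 0)
    refl q z (qnum (suc k))

  Y-foldTo : ∀ n (v : ℕ → Seq) k → Y (λ k → foldTo n (λ c → v c k)) k ≈ foldTo n (λ c → Y (v c) k)
  Y-foldTo zero    v k = Y-0 k
  Y-foldTo (suc n) v k = trans (Y-+ _ (v n) k) (+-congʳ (Y-foldTo n v k))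

  -- A twisted product rule: for y = q x + z, x f(x) - y f(y) = (x - y) f(x) + y (f(x) - f(y)). In
  -- coordinates it rests on [k+1] = 1 + q [k].
  ∂X : ∀ v k → ∂ (X v) k ≈ v k + Y (∂ v) k
  ∂X v zero = begin
    qnum 1 * (v 0 + z * (qnum 1 * v 1))           ≈⟨ *-congʳ (trans (+-identityˡ _) Q-0) ⟩
    1# * (v 0 + z * (qnum 1 * v 1))
      ≈⟨ solve 4 (λ a z b q → con 1 :* (a :+ z :* b) := a :+ (q :* con 0 :+ z :* b)) refl _ _ _ q ⟩
    v 0 + (q * 0# + z * (qnum 1 * v 1))         ∎
  ∂X v (suc k) = begin
    b′ * (v (suc k) + z * (b′ * v (suc (suc k))))                ≈⟨ *-congʳ (qnum-suc (suc k)) ⟩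
    (1# + q * b) * (v (suc k) + z * (b′ * v (suc (suc k))))
      ≈⟨ solve 5 (λ q b v₁ z u → (con 1 :+ q :* b) :* (v₁ :+ z :* u)
           := v₁ :+ (q :* (b :* v₁ :+ z :* (b :* u)) :+ z :* u)) refl q b _ z _ ⟩
    v (suc k) + Y (∂ v) (suc k)                                  ∎
    where
    b = qnum (suc k)
    b′ = qnum (suc (suc k))

  x^ : ℕ → Seq
  x^ zero    zero    = 1#
  x^ zero    (suc k) = 0#
  x^ (suc n) k       = X (x^ n) k

  xy^ : ℕ → ℕ → Seq
  xy^ a zero    = x^ a
  xy^ a (suc b) = Y (xy^ a b)

  X-xy^ : ∀ a b k → X (xy^ a b) k ≈ xy^ (suc a) b k
  X-xy^ a zero    k = refl
  X-xy^ a (suc b) k = trans (XY≈YX (xy^ a b) k) (Y-cong (X-xy^ a b) k)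

  X-support : ∀ {N v} → (∀ {k} → N < k → v k ≈ 0#) → ∀ {k} → suc N < k → X v k ≈ 0#
  X-support v≈0 {suc k} (s≤s N<k) = begin
    _ + z * (_ * _)       ≈⟨ +-cong (v≈0 N<k) (*-congˡ (*-congˡ (v≈0 (ℕ.m<n⇒m<1+n N<k)))) ⟩
    0# + z * (_ * 0#)     ≈⟨ solve 2 (λ z b → con 0 :+ z :* (b :* con 0) := con 0) refl _ _ ⟩
    0#                    ∎

  Y-support : ∀ {N v} → (∀ {k} → N < k → v k ≈ 0#) → ∀ {k} → suc N < k → Y v k ≈ 0#
  Y-support {N} {v} v≈0 {k} N<k = begin
    q * X v k + z * v k ≈⟨ +-cong (*-congˡ (X-support {v = v} v≈0 N<k)) (*-congˡ (v≈0 (ℕ.<-trans (ℕ.n<1+n N) N<k))) ⟩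
    q * 0# + z * 0#     ≈⟨ solve 2 (λ q z → q :* con 0 :+ z :* con 0 := con 0) refl q z ⟩
    0#                  ∎

  xy^-support : ∀ a b {k} → b ℕ.+ a < k → xy^ a b k ≈ 0#
  xy^-support zero    zero    {suc k} _ = refl
  xy^-support (suc a) zero    = X-support {v = x^ a} (xy^-support a zero)
  xy^-support a       (suc b) = Y-support {v = xy^ a b} (xy^-support a b)

  -- The factorization of x^n - y^n by x - y, obtained without dividing by iterating `∂X`.
  ∂-x^ : ∀ n k → ∂ (x^ n) k ≈ foldTo n (λ c → xy^ (n ∸ suc c) c k)
  ∂-x^ zero    k = zeroʳ _
  ∂-x^ (suc n) k = begin
    ∂ (X (x^ n)) k                                             ≈⟨ ∂X (x^ n) k ⟩
    x^ n k + Y (∂ (x^ n)) k                                    ≈⟨ +-congˡ (Y-cong (∂-x^ n) k) ⟩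
    x^ n k + Y (λ k → foldTo n (λ c → xy^ (n ∸ suc c) c k)) k  ≈⟨ +-congˡ (Y-foldTo n (λ c → xy^ (n ∸ suc c) c) k) ⟩
    x^ n k + foldTo n (λ c → xy^ (n ∸ suc c) (suc c) k)        ≈⟨ foldTo-head n (λ c → xy^ (n ∸ c) c k) ⟨
    foldTo (suc n) (λ c → xy^ (n ∸ c) c k)                     ∎

  -- Invariance under `∂` up to the coordinate at 0, by [k+1]! = [k]! [k+1]. The bound drops by one
  -- because `∂` lowers the index.
  L∂ : ∀ N v → L (suc N) v ≈ v 0 + L N (∂ v)
  L∂ N v = trans (foldTo-head (suc N) _) (+-cong (*-identityˡ _)
    (foldTo-cong (suc N) λ _ → *-assoc _ _ _))

  L-foldTo : ∀ N n (v : ℕ → Seq) → L N (λ k → foldTo n (λ c → v c k)) ≈ foldTo n (λ c → L N (v c))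
  L-foldTo N n v = trans (foldTo-cong (suc N) (λ _ → *-distribˡ-foldTo _ n _))
                         (foldTo-comm (suc N) n _)

  L-Y : ∀ N v → L N (Y v) ≈ q * L N (X v) + z * L N v
  L-Y N v = begin
    L N (Y v)
      ≈⟨ foldTo-cong (suc N) (λ _ → solve 5 (λ f q x z v → f :* (q :* x :+ z :* v)
           := q :* (f :* x) :+ z :* (f :* v)) refl _ _ _ _ _) ⟩
    foldTo (suc N) (λ k → q * (qfact k * X v k) + z * (qfact k * v k))
      ≈⟨ foldTo-∙ (suc N) _ _ ⟩
    foldTo (suc N) (λ k → q * (qfact k * X v k)) + foldTo (suc N) (λ k → z * (qfact k * v k))
      ≈⟨ +-cong (*-distribˡ-foldTo q (suc N) _) (*-distribˡ-foldTo z (suc N) _) ⟨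
    q * L N (X v) + z * L N v ∎

  -- The first recurrence of K for `L`: a positive power of x has coordinate 0 at index 0, so `L∂`
  -- loses nothing.
  L-x^ : ∀ n → L (suc n) (x^ (suc n)) ≈ foldTo (suc n) (λ c → L n (xy^ (n ∸ c) c))
  L-x^ n = begin
    L (suc n) (x^ (suc n))                              ≈⟨ L∂ n (x^ (suc n)) ⟩
    0# + L n (∂ (x^ (suc n)))                           ≈⟨ +-identityˡ _ ⟩
    L n (∂ (x^ (suc n)))                                ≈⟨ L-cong n (∂-x^ (suc n)) ⟩
    L n (λ k → foldTo (suc n) (λ c → xy^ (n ∸ c) c k))  ≈⟨ L-foldTo n (suc n) (λ c → xy^ (n ∸ c) c) ⟩
    foldTo (suc n) (λ c → L n (xy^ (n ∸ c) c))          ∎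

  -- The recurrence in `c` expands one factor y = q x + z, and moving its x to the front raises the
  -- exponent of x.
  L-xy^≈codeSum : ∀ n c → c ≤ n → L n (xy^ (n ∸ c) c) ≈ codeSum n c
  L-xy^≈codeSum = codeSum-unique (λ n c → L n (xy^ (n ∸ c) c))
    (trans (+-identityˡ _) (*-identityˡ _)) L-x^ λ n c c≤n → begin
      L (suc n) (Y (xy^ (n ∸ c) c))
        ≈⟨ L-Y (suc n) (xy^ (n ∸ c) c) ⟩
      q * L (suc n) (X (xy^ (n ∸ c) c)) + z * L (suc n) (xy^ (n ∸ c) c)
        -- The polynomial in the second term has degree n, so its coordinate at n + 1 vanishes and
        -- `L (suc n)` may be replaced by `L n`.
        ≈⟨ +-cong (*-congˡ (L-cong (suc n) (X-xy^ (n ∸ c) c)))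
             (*-congˡ (trans (+-congˡ (trans (*-congˡ (xy^-support (n ∸ c) c
               (s≤s (ℕ.≤-reflexive (ℕ.m+[n∸m]≡n c≤n))))) (zeroʳ _))) (+-identityʳ _))) ⟩
      q * L (suc n) (xy^ (suc (n ∸ c)) c) + z * L n (xy^ (n ∸ c) c)
        ≡⟨ ≡.cong (λ a → q * L (suc n) (xy^ a c) + z * L n (xy^ (n ∸ c) c)) (≡.sym (ℕ.+-∸-assoc 1 c≤n)) ⟩
      q * L (suc n) (xy^ (suc n ∸ c) c) + z * L n (xy^ (n ∸ c) c) ∎

  ∑codeSum≈stirling : ∀ n → foldTo (suc n) (codeSum n) ≈ foldTo (suc n) (λ k → qfact (suc k) * x^ (suc n) (suc k))
  ∑codeSum≈stirling n = begin
    foldTo (suc n) (codeSum n)                  ≈⟨ foldTo-cong (suc n) (λ { (s≤s c≤n) → L-xy^≈codeSum n _ c≤n }) ⟨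
    foldTo (suc n) (λ c → L n (xy^ (n ∸ c) c))  ≈⟨ L-x^ n ⟨
    L (suc n) (x^ (suc n))                      ≈⟨ foldTo-head (suc n) _ ⟩
    1# * 0# + foldTo (suc n) (λ k → qfact (suc k) * x^ (suc n) (suc k))
      ≈⟨ trans (+-congʳ (zeroʳ _)) (+-identityˡ _) ⟩
    foldTo (suc n) (λ k → qfact (suc k) * x^ (suc n) (suc k))   ∎

-- Appending a last letter to a permutation

module LastLetter where

  open import Data.Nat.Base using (_+_)
  open import Relation.Binary.PropositionalEquality

  module Σℕ = FiniteSum ℕ.+-0-commutativeMonoid

  infixl 5 _▹_

  -- Relabelling by `punchIn p` frees the value `p` and keeps the relative order of the earlier
  -- letters, hence their descents and code entries.
  _▹_ : ∀ {n} → Word n → Fin (suc n) → Word (suc n)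
  σ ▹ p = Vec.map (punchIn p) σ ∷ʳ p

  lookup-∷ʳ-inject₁ : ∀ {A : Set} {n} (xs : Vec A n) x i → lookup (xs ∷ʳ x) (inject₁ i) ≡ lookup xs i
  lookup-∷ʳ-inject₁ (y ∷ xs) x zero    = refl
  lookup-∷ʳ-inject₁ (y ∷ xs) x (suc i) = lookup-∷ʳ-inject₁ xs x i

  lookup-∷ʳ-fromℕ : ∀ {A : Set} {n} (xs : Vec A n) x → lookup (xs ∷ʳ x) (fromℕ n) ≡ x
  lookup-∷ʳ-fromℕ []       x = refl
  lookup-∷ʳ-fromℕ (y ∷ xs) x = lookup-∷ʳ-fromℕ xs x

  lookup-▹-inject₁ : ∀ {n} (σ : Word n) p i → lookup (σ ▹ p) (inject₁ i) ≡ punchIn p (lookup σ i)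
  lookup-▹-inject₁ σ p i =
    trans (lookup-∷ʳ-inject₁ (Vec.map (punchIn p) σ) p i) (lookup-map i (punchIn p) σ)

  lookup-▹-fromℕ : ∀ {n} (σ : Word n) p → lookup (σ ▹ p) (fromℕ n) ≡ p
  lookup-▹-fromℕ σ p = lookup-∷ʳ-fromℕ (Vec.map (punchIn p) σ) p

  lookup-ext : ∀ {A : Set} {n} (xs ys : Vec A n) → (∀ i → lookup xs i ≡ lookup ys i) → xs ≡ ys
  lookup-ext xs ys eq = trans (sym (tabulate∘lookup xs)) (trans (tabulate-cong eq) (tabulate∘lookup ys))

  lookup-injective⇒Unique : ∀ {A : Set} {n} (xs : Vec A n) →
                            (∀ i j → lookup xs i ≡ lookup xs j → i ≡ j) → Unique xs
  lookup-injective⇒Unique xs inj =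
    subst Unique (tabulate∘lookup xs) (Vec.tabulate⁺ (λ {i} {j} → inj i j))

  ▹-Unique : ∀ {n} {σ : Word n} p → Unique σ → Unique (σ ▹ p)
  ▹-Unique {n} {σ} p σ! = lookup-injective⇒Unique (σ ▹ p) inj
    where
    inj : ∀ i j → lookup (σ ▹ p) i ≡ lookup (σ ▹ p) j → i ≡ j
    inj i j eq with view i | view j
    ... | ‵fromℕ     | ‵fromℕ     = refl
    ... | ‵fromℕ     | ‵inject₁ j = contradiction
      (trans (sym (lookup-▹-inject₁ σ p j)) (trans (sym eq) (lookup-▹-fromℕ σ p))) (Fin.punchInᵢ≢i p _)
    ... | ‵inject₁ i | ‵fromℕ     = contradiction
      (trans (sym (lookup-▹-inject₁ σ p i)) (trans eq (lookup-▹-fromℕ σ p))) (Fin.punchInᵢ≢i p _)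
    ... | ‵inject₁ i | ‵inject₁ j = cong inject₁ (Vec.lookup-injective σ! i j
      (Fin.punchIn-injective p _ _ (trans (sym (lookup-▹-inject₁ σ p i)) (trans eq (lookup-▹-inject₁ σ p j)))))

  ▹-surjective : ∀ {n} (w : Word (suc n)) → Unique w → ∃₂ λ σ p → Unique σ × w ≡ σ ▹ p
  ▹-surjective {n} w w! = σ , p , σ! , lookup-ext w (σ ▹ p) w≗
    where
    p = lookup w (fromℕ n)
    p≢ : ∀ i → p ≢ lookup w (inject₁ i)
    p≢ i eq = Fin.fromℕ≢inject₁ (Vec.lookup-injective w! _ _ eq)
    σ = tabulate (λ i → punchOut (p≢ i))
    σ! : Unique σ
    σ! = Vec.tabulate⁺ λ {i} {j} eq →
      Fin.inject₁-injective (Vec.lookup-injective w! _ _ (Fin.punchOut-injective (p≢ i) (p≢ j) eq))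
    w≗ : ∀ i → lookup w i ≡ lookup (σ ▹ p) i
    w≗ i with view i
    ... | ‵fromℕ     = sym (lookup-▹-fromℕ σ p)
    ... | ‵inject₁ i = sym (trans (lookup-▹-inject₁ σ p i)
      (trans (cong (punchIn p) (lookup∘tabulate _ i)) (Fin.punchIn-punchOut (p≢ i))))

  ▹-injective : ∀ {n} {σ τ : Word n} {p p′} → σ ▹ p ≡ τ ▹ p′ → σ ≡ τ × p ≡ p′
  ▹-injective {σ = σ} {τ} {p} eq with ∷ʳ-injective (Vec.map _ σ) (Vec.map _ τ) eq
  ... | maps≡ , refl = lookup-ext σ τ (λ i → Fin.punchIn-injective p _ _
    (trans (sym (lookup-map i _ σ)) (trans (cong (λ v → lookup v i) maps≡) (lookup-map i _ τ)))) , refl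

  ∈-words : ∀ {A : Set} {as : List A} → (∀ a → a ∈ as) → ∀ {n} (w : Vec A n) → w ∈ words as n
  ∈-words ∈as []      = Any.here refl
  ∈-words ∈as (a ∷ w) = ∈-cartesianProductWith⁺ _∷_ (∈as a) (∈-words ∈as w)

  words-Unique : ∀ {A : Set} {as : List A} → List.Unique as → ∀ n → List.Unique (words as n)
  words-Unique as! zero    = [] ∷ []
  words-Unique as! (suc n) = List.cartesianProductWith⁺ _∷_ ∷-injective as! (words-Unique as! n)

  𝔖-Unique : ∀ n → List.Unique (𝔖 n)
  𝔖-Unique n = List.filter⁺ unique? (words-Unique (List.allFin⁺ n) n)

  ∈-𝔖⁺ : ∀ {n} {σ : Word n} → Unique σ → σ ∈ 𝔖 n
  ∈-𝔖⁺ {σ = σ} σ! = ∈-filter⁺ unique? (∈-words ∈-allFin σ) σ!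

  ∈-𝔖⁻ : ∀ {n} {σ : Word n} → σ ∈ 𝔖 n → Unique σ
  ∈-𝔖⁻ {n} σ∈𝔖 = proj₂ (∈-filter⁻ unique? {xs = words (allFin n) n} σ∈𝔖)

  -- Both lists are free of repetitions and have the same members, since every permutation arises
  -- from a unique shorter one and a unique last letter.
  𝔖-suc-↭ : ∀ n → 𝔖 (suc n) ↭ cartesianProductWith _▹_ (𝔖 n) (allFin (suc n))
  𝔖-suc-↭ n = ∼bag⇒↭ (unique∧set⇒bag (𝔖-Unique (suc n))
    (List.cartesianProductWith⁺ _▹_ ▹-injective (𝔖-Unique n) (List.allFin⁺ (suc n)))
    (mk⇔ to from′))
    where
    to : ∀ {w} → w ∈ 𝔖 (suc n) → w ∈ cartesianProductWith _▹_ (𝔖 n) (allFin (suc n))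
    to {w} w∈𝔖 with ▹-surjective w (∈-𝔖⁻ w∈𝔖)
    ... | σ , p , σ! , refl = ∈-cartesianProductWith⁺ _▹_ (∈-𝔖⁺ σ!) (∈-allFin p)
    from′ : ∀ {w} → w ∈ cartesianProductWith _▹_ (𝔖 n) (allFin (suc n)) → w ∈ 𝔖 (suc n)
    from′ w∈ with ∈-cartesianProductWith⁻ _▹_ (𝔖 n) (allFin (suc n)) w∈
    ... | σ , p , σ∈𝔖 , _ , refl = ∈-𝔖⁺ (▹-Unique p (∈-𝔖⁻ σ∈𝔖))

  -- Reindexing along a permutation: with the last letter `p` removed, `punchIn p` runs through the
  -- remaining values.
  sum-Unique : ∀ {n} (σ : Word n) → Unique σ → (f : Fin n → ℕ) → Σℕ.sum (f ∘ lookup σ) ≡ Σℕ.sum f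
  sum-Unique {zero}  [] _  f = refl
  sum-Unique {suc n} w  w! f with ▹-surjective w w!
  ... | σ , p , σ! , refl = begin
    Σℕ.sum (f ∘ lookup (σ ▹ p))
      ≡⟨ Σℕ.sum-init-last (f ∘ lookup (σ ▹ p)) ⟩
    Σℕ.sum (λ i → f (lookup (σ ▹ p) (inject₁ i))) + f (lookup (σ ▹ p) (fromℕ n))
      ≡⟨ cong₂ _+_ (Σℕ.sum-cong-≋ (λ i → cong f (lookup-▹-inject₁ σ p i))) (cong f (lookup-▹-fromℕ σ p)) ⟩
    Σℕ.sum (f ∘ punchIn p ∘ lookup σ) + f p
      ≡⟨ cong (_+ f p) (sum-Unique σ σ! (f ∘ punchIn p)) ⟩
    Σℕ.sum (f ∘ punchIn p) + f p
      ≡⟨ ℕ.+-comm _ (f p) ⟩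
    f p + Σℕ.sum (f ∘ punchIn p)
      ≡⟨ Σℕ.sum-remove f ⟨
    Σℕ.sum f ∎
    where open ≡-Reasoning

  -- Inversions, descents and the last code entry.

  𝟙 : Bool → ℕ
  𝟙 b = if b then 1 else 0

  length-fold : ∀ {A : Set} (xs : List A) → length xs ≡ Σℕ.fold xs (λ _ → 1)
  length-fold []       = refl
  length-fold (x ∷ xs) = cong suc (length-fold xs)

  inversion : ∀ {n} → Word n → Fin n → Fin n → ℕ
  inversion σ i j = 𝟙 (does ((i Fin.<? j) ×-dec (lookup σ j Fin.<? lookup σ i)))

  inv□-sum : ∀ {n} (σ : Word n) j → inv□ j σ ≡ Σℕ.sum (λ i → inversion σ i j)
  inv□-sum {n} σ j = trans (length-fold (filter _ (allFin n)))
    (trans (Σℕ.fold-filter _ (allFin n) (λ _ → 1)) (Σℕ.fold-allFin n _))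

  inv-sum : ∀ {n} (σ : Word n) → inv σ ≡ Σℕ.sum (λ j → inv□ j σ)
  inv-sum {n} σ = begin
    inv σ
      ≡⟨ length-fold (filter inverted? (cartesianProduct (allFin n) (allFin n))) ⟩
    Σℕ.fold (filter inverted? (cartesianProduct (allFin n) (allFin n))) (λ _ → 1)
      ≡⟨ Σℕ.fold-filter inverted? (cartesianProduct (allFin n) (allFin n)) _ ⟩
    Σℕ.fold (cartesianProduct (allFin n) (allFin n)) (λ (i , j) → inversion σ i j)
      ≡⟨ Σℕ.fold-product _,_ (allFin n) (allFin n) _ ⟩
    Σℕ.fold (allFin n) (λ i → Σℕ.fold (allFin n) (inversion σ i))
      ≡⟨ Σℕ.fold-comm (allFin n) (allFin n) (inversion σ) ⟩
    Σℕ.fold (allFin n) (λ j → Σℕ.fold (allFin n) (λ i → inversion σ i j))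
      ≡⟨ Σℕ.fold-cong (allFin n) (λ j → trans (Σℕ.fold-allFin n _) (sym (inv□-sum σ j))) ⟩
    Σℕ.fold (allFin n) (λ j → inv□ j σ)
      ≡⟨ Σℕ.fold-allFin n _ ⟩
    Σℕ.sum (λ j → inv□ j σ) ∎
    where
    open ≡-Reasoning
    inverted? : (ij : Fin n × Fin n) → Dec _
    inverted? (i , j) = (i Fin.<? j) ×-dec (lookup σ j Fin.<? lookup σ i)

  punchIn-< : ∀ {n} p (a b : Fin n) → punchIn p a Fin.< punchIn p b ⇔ a Fin.< b
  punchIn-< p a b = mk⇔
    (λ ↑a<↑b → ℕ.≰⇒> (λ b≤a → ℕ.<⇒≱ ↑a<↑b (Fin.punchIn-mono-≤ p b a b≤a)))
    (λ a<b → ℕ.≰⇒> (λ ↑b≤↑a → ℕ.<⇒≱ a<b (Fin.punchIn-cancel-≤ p b a ↑b≤↑a)))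

  inject₁-< : ∀ {n} (i j : Fin n) → inject₁ i Fin.< inject₁ j ⇔ i Fin.< j
  inject₁-< i j = mk⇔ (subst₂ _<_ (Fin.toℕ-inject₁ i) (Fin.toℕ-inject₁ j))
                      (subst₂ _<_ (sym (Fin.toℕ-inject₁ i)) (sym (Fin.toℕ-inject₁ j)))

  does-<?-▹ : ∀ {n} (σ : Word n) p i j →
              does (lookup (σ ▹ p) (inject₁ i) Fin.<? lookup (σ ▹ p) (inject₁ j)) ≡ does (lookup σ i Fin.<? lookup σ j)
  does-<?-▹ σ p i j rewrite lookup-▹-inject₁ σ p i | lookup-▹-inject₁ σ p j =
    does-⇔ (punchIn-< p (lookup σ i) (lookup σ j)) (_ Fin.<? _) (_ Fin.<? _)

  inv□-▹-inject₁ : ∀ {n} (σ : Word n) p j → inv□ (inject₁ j) (σ ▹ p) ≡ inv□ j σ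
  inv□-▹-inject₁ {n} σ p j = begin
    inv□ (inject₁ j) (σ ▹ p)
      ≡⟨ inv□-sum (σ ▹ p) (inject₁ j) ⟩
    Σℕ.sum (λ i → inversion (σ ▹ p) i (inject₁ j))
      ≡⟨ Σℕ.sum-init-last (λ i → inversion (σ ▹ p) i (inject₁ j)) ⟩
    Σℕ.sum (λ i → inversion (σ ▹ p) (inject₁ i) (inject₁ j)) + inversion (σ ▹ p) (fromℕ n) (inject₁ j)
      ≡⟨ cong₂ _+_ (Σℕ.sum-cong-≋ same) (cong 𝟙 (dec-false
           ((fromℕ n Fin.<? inject₁ j) ×-dec (lookup (σ ▹ p) (inject₁ j) Fin.<? lookup (σ ▹ p) (fromℕ n)))
           (λ (n<j , _) → ℕ.<⇒≱ n<j (Fin.≤fromℕ (inject₁ j))))) ⟩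
    Σℕ.sum (λ i → inversion σ i j) + 0
      ≡⟨ ℕ.+-identityʳ _ ⟩
    Σℕ.sum (λ i → inversion σ i j)
      ≡⟨ inv□-sum σ j ⟨
    inv□ j σ ∎
    where
    open ≡-Reasoning
    same : ∀ i → inversion (σ ▹ p) (inject₁ i) (inject₁ j) ≡ inversion σ i j
    same i = cong 𝟙 (cong₂ _∧_ (does-⇔ (inject₁-< i j) (inject₁ i Fin.<? inject₁ j) (i Fin.<? j)) (does-<?-▹ σ p j i))

  count-> : ∀ n k → Σℕ.sum {n} (λ a → 𝟙 (k <ᵇ toℕ a)) ≡ n ∸ suc k
  count-> zero    k       = refl
  count-> (suc n) zero    = ones n
    where
    ones : ∀ n → Σℕ.sum {n} (λ _ → 1) ≡ n
    ones zero    = refl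
    ones (suc n) = cong suc (ones n)
  count-> (suc n) (suc k) = count-> n k

  -- Every other position precedes the last one, so the entry counts all values above the last
  -- letter, wherever they stand.
  inv□-fromℕ : ∀ {n} (σ : Word (suc n)) → Unique σ → inv□ (fromℕ n) σ ≡ n ∸ toℕ (lookup σ (fromℕ n))
  inv□-fromℕ {n} σ σ! = begin
    inv□ (fromℕ n) σ                                       ≡⟨ inv□-sum σ (fromℕ n) ⟩
    Σℕ.sum (λ i → inversion σ i (fromℕ n))                 ≡⟨ Σℕ.sum-cong-≋ above ⟩
    Σℕ.sum ((λ a → 𝟙 (toℕ s <ᵇ toℕ a)) ∘ lookup σ)         ≡⟨ sum-Unique σ σ! (λ a → 𝟙 (toℕ s <ᵇ toℕ a)) ⟩
    Σℕ.sum {suc n} (λ a → 𝟙 (toℕ s <ᵇ toℕ a))              ≡⟨ count-> (suc n) (toℕ s) ⟩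
    n ∸ toℕ s                                              ∎
    where
    open ≡-Reasoning
    s = lookup σ (fromℕ n)
    above : ∀ i → inversion σ i (fromℕ n) ≡ 𝟙 (does (s Fin.<? lookup σ i))
    above i with view i
    ... | ‵fromℕ = trans
      (cong 𝟙 (dec-false ((fromℕ n Fin.<? fromℕ n) ×-dec (s Fin.<? s)) (λ (n<n , _) → ℕ.<-irrefl refl n<n)))
      (sym (cong 𝟙 (dec-false (s Fin.<? s) (ℕ.<-irrefl refl))))
    ... | ‵inject₁ i = cong (λ b → 𝟙 (b ∧ does (s Fin.<? lookup σ (inject₁ i))))
      (dec-true (inject₁ i Fin.<? fromℕ n) (subst₂ _<_ (sym (Fin.toℕ-inject₁ i)) (sym (Fin.toℕ-fromℕ n)) (Fin.toℕ<n i)))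

  inv□-▹-fromℕ : ∀ {n} (σ : Word n) p → Unique σ → inv□ (fromℕ n) (σ ▹ p) ≡ n ∸ toℕ p
  inv□-▹-fromℕ {n} σ p σ! =
    trans (inv□-fromℕ (σ ▹ p) (▹-Unique p σ!)) (cong (λ a → n ∸ toℕ a) (lookup-▹-fromℕ σ p))

  inv-▹ : ∀ {n} (σ : Word n) p → Unique σ → inv (σ ▹ p) ≡ inv σ + (n ∸ toℕ p)
  inv-▹ {n} σ p σ! = begin
    inv (σ ▹ p)
      ≡⟨ inv-sum (σ ▹ p) ⟩
    Σℕ.sum (λ j → inv□ j (σ ▹ p))
      ≡⟨ Σℕ.sum-init-last (λ j → inv□ j (σ ▹ p)) ⟩
    Σℕ.sum (λ j → inv□ (inject₁ j) (σ ▹ p)) + inv□ (fromℕ n) (σ ▹ p)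
      ≡⟨ cong₂ _+_ (Σℕ.sum-cong-≋ (inv□-▹-inject₁ σ p)) (inv□-▹-fromℕ σ p σ!) ⟩
    Σℕ.sum (λ j → inv□ j σ) + (n ∸ toℕ p)
      ≡⟨ cong (_+ (n ∸ toℕ p)) (inv-sum σ) ⟨
    inv σ + (n ∸ toℕ p) ∎
    where open ≡-Reasoning

  code : ∀ {m} → Word (suc m) → ℕ
  code {m} σ = inv□ (fromℕ m) σ

  <-punchIn : ∀ {n} p (a : Fin n) → p Fin.< punchIn p a ⇔ toℕ p ≤ toℕ a
  <-punchIn p a = mk⇔ (to p a) (from′ p a)
    where
    to : ∀ {n} p (a : Fin n) → p Fin.< punchIn p a → toℕ p ≤ toℕ a
    to zero    a       _         = z≤n
    to (suc p) zero    ()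
    to (suc p) (suc a) (s≤s p<a) = s≤s (to p a p<a)
    from′ : ∀ {n} p (a : Fin n) → toℕ p ≤ toℕ a → p Fin.< punchIn p a
    from′ zero    a       _         = s≤s z≤n
    from′ (suc p) (suc a) (s≤s p≤a) = s≤s (from′ p a p≤a)

  module _ {m} (σ : Word (suc m)) (p : Fin (suc (suc m))) (σ! : Unique σ) where

    private
      s = lookup σ (fromℕ m)

      -- The code entries are `m - s` before and `m + 1 - p` after appending; complementing reverses
      -- the order and the extra 1 makes the inequality strict.
      ≤⇔code< : toℕ p ≤ toℕ s ⇔ code σ < suc m ∸ toℕ p
      ≤⇔code< rewrite inv□-fromℕ σ σ! = mk⇔
        (λ p≤s → subst (_≤ suc m ∸ toℕ p) (ℕ.+-∸-assoc 1 s≤m) (ℕ.∸-monoʳ-≤ (suc m) p≤s))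
        (λ c<c′ → ℕ.≮⇒≥ λ s<p → ℕ.<⇒≱ c<c′ (ℕ.∸-monoʳ-≤ (suc m) s<p))
        where
        s≤m : toℕ s ≤ m
        s≤m = ℕ.≤-pred (Fin.toℕ<n s)

    -- The old last letter `s` becomes `punchIn p s`, which exceeds `p` exactly when `p ≤ s`.
    descent-▹ : does (lookup (σ ▹ p) (fromℕ (suc m)) Fin.<? lookup (σ ▹ p) (inject₁ (fromℕ m)))
                ≡ (code σ <ᵇ suc m ∸ toℕ p)
    descent-▹ rewrite lookup-▹-fromℕ σ p | lookup-▹-inject₁ σ p (fromℕ m) =
      does-⇔ (mk⇔ (to ≤⇔code< ∘ to (<-punchIn p s)) (from′ (<-punchIn p s) ∘ from′ ≤⇔code<))
        (_ Fin.<? _) (code σ ℕ.<? suc m ∸ toℕ p)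
      where open Equivalence renaming (from to from′)

    ascent-▹ : does (lookup (σ ▹ p) (inject₁ (fromℕ m)) Fin.<? lookup (σ ▹ p) (fromℕ (suc m)))
               ≡ not (code σ <ᵇ suc m ∸ toℕ p)
    ascent-▹ = trans complement (cong not descent-▹)
      where
      a = lookup (σ ▹ p) (inject₁ (fromℕ m))
      b = lookup (σ ▹ p) (fromℕ (suc m))
      a≢b : a ≢ b
      a≢b eq = Fin.fromℕ≢inject₁ (sym (Vec.lookup-injective (▹-Unique p σ!) _ _ eq))
      complement : does (a Fin.<? b) ≡ not (does (b Fin.<? a))
      complement with ℕ.<-cmp (toℕ a) (toℕ b)
      ... | tri< a<b _ b≮a = trans (dec-true (a Fin.<? b) a<b) (cong not (sym (dec-false (b Fin.<? a) b≮a)))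
      ... | tri≈ _ a≡b _   = contradiction (Fin.toℕ-injective a≡b) a≢b
      ... | tri> a≮b _ b<a = trans (dec-false (a Fin.<? b) a≮b) (cong not (sym (dec-true (b Fin.<? a) b<a)))

  does-∈? : ∀ {m} (i : Fin m) (S : Subset m) → does (i ∈? S) ≡ lookup S i
  does-∈? zero    (inside  ∷ S) = refl
  does-∈? zero    (outside ∷ S) = refl
  does-∈? (suc i) (s ∷ S)       = does-∈? i S

  ∣∣-sum : ∀ {m} (S : Subset m) → ∣ S ∣ ≡ Σℕ.sum (λ i → 𝟙 (lookup S i))
  ∣∣-sum []            = refl
  ∣∣-sum (outside ∷ S) = ∣∣-sum S
  ∣∣-sum (inside  ∷ S) = cong suc (∣∣-sum S)

open LastLetter

-- Sums and products over descent and ascent sets.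

module ElementSum (M : CommutativeMonoid 0ℓ 0ℓ) where
  open CommutativeMonoid M
  open FiniteSum M
  open import Relation.Binary.Reasoning.Setoid setoid

  fold-elements : ∀ {m} (S : Subset m) f →
                  fold (elements S) f ≈ sum (λ i → if lookup S i then f i else ε)
  fold-elements {m} S f = begin
    fold (elements S) f
      ≈⟨ fold-filter (_∈? S) (allFin m) f ⟩
    fold (allFin m) (λ i → if does (i ∈? S) then f i else ε)
      ≈⟨ fold-cong (allFin m) (λ i → reflexive (≡.cong (if_then f i else ε) (does-∈? i S))) ⟩
    fold (allFin m) (λ i → if lookup S i then f i else ε)
      ≡⟨ fold-allFin m _ ⟩
    sum (λ i → if lookup S i then f i else ε) ∎

  fold-elements-tabulate : ∀ {m} (b : Fin (suc m) → Bool) f →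
    fold (elements (tabulate b)) f
    ≈ fold (elements (tabulate (b ∘ inject₁))) (f ∘ inject₁) ∙ (if b (fromℕ m) then f (fromℕ m) else ε)
  fold-elements-tabulate {m} b f = begin
    fold (elements (tabulate b)) f
      ≈⟨ fold-elements (tabulate b) f ⟩
    sum (λ i → if lookup (tabulate b) i then f i else ε)
      ≈⟨ sum-cong-≋ (λ i → reflexive (≡.cong (if_then f i else ε) (lookup∘tabulate b i))) ⟩
    sum (λ i → if b i then f i else ε)
      ≈⟨ sum-init-last (λ i → if b i then f i else ε) ⟩
    sum (λ i → if b (inject₁ i) then f (inject₁ i) else ε) ∙ (if b (fromℕ m) then f (fromℕ m) else ε)
      ≈⟨ ∙-congʳ (sum-cong-≋ (λ i → reflexive (≡.cong (if_then f (inject₁ i) else ε)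
           (≡.sym (lookup∘tabulate (b ∘ inject₁) i))))) ⟩
    sum (λ i → if lookup (tabulate (b ∘ inject₁)) i then f (inject₁ i) else ε) ∙ _
      ≈⟨ ∙-congʳ (fold-elements (tabulate (b ∘ inject₁)) (f ∘ inject₁)) ⟨
    fold (elements (tabulate (b ∘ inject₁))) (f ∘ inject₁) ∙ (if b (fromℕ m) then f (fromℕ m) else ε) ∎

  -- Appending a letter decides one new position only. A general monoid covers both the sums behind
  -- `maj` and `des` and the products in the weights.
  fold-Des-▹ : ∀ {m} (σ : Word (suc m)) p → Unique σ → ∀ f →
    fold (elements (Des (σ ▹ p))) f
    ≈ fold (elements (Des σ)) (f ∘ inject₁) ∙ (if code σ <ᵇ suc m ∸ toℕ p then f (fromℕ m) else ε)
  fold-Des-▹ {m} σ p σ! f = trans (fold-elements-tabulate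
    (λ i → does (lookup (σ ▹ p) (next i) Fin.<? lookup (σ ▹ p) (here i))) f) (reflexive (≡.cong₂ _∙_
    (≡.cong (λ S → fold (elements S) (f ∘ inject₁)) (tabulate-cong (λ i → does-<?-▹ σ p (suc i) (inject₁ i))))
    (≡.cong (if_then f (fromℕ m) else ε) (descent-▹ σ p σ!))))

  fold-Asc-▹ : ∀ {m} (σ : Word (suc m)) p → Unique σ → ∀ f →
    fold (elements (Asc (σ ▹ p))) f
    ≈ fold (elements (Asc σ)) (f ∘ inject₁) ∙ (if not (code σ <ᵇ suc m ∸ toℕ p) then f (fromℕ m) else ε)
  fold-Asc-▹ {m} σ p σ! f = trans (fold-elements-tabulate
    (λ i → does (lookup (σ ▹ p) (here i) Fin.<? lookup (σ ▹ p) (next i))) f) (reflexive (≡.cong₂ _∙_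
    (≡.cong (λ S → fold (elements S) (f ∘ inject₁)) (tabulate-cong (λ i → does-<?-▹ σ p (inject₁ i) (suc i))))
    (≡.cong (if_then f (fromℕ m) else ε) (ascent-▹ σ p σ!))))

module Eℕ = ElementSum ℕ.+-0-commutativeMonoid

∣∣-fold : ∀ {m} (S : Subset m) → ∣ S ∣ ≡ Σℕ.fold (elements S) (λ _ → 1)
∣∣-fold S = ≡.trans (∣∣-sum S) (≡.sym (Eℕ.fold-elements S (λ _ → 1)))

∣∣-length : ∀ {m} (S : Subset m) → ∣ S ∣ ≡ length (elements S)
∣∣-length S = ≡.trans (∣∣-fold S) (≡.sym (length-fold (elements S)))

maj-fold : ∀ {n} (σ : Word n) → maj σ ≡ Σℕ.fold (elements (Des σ)) index
maj-fold σ = ≡.sym (Σℕ.fold≈foldr-map (elements (Des σ)) index)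

des-▹ : ∀ {m} (σ : Word (suc m)) p → Unique σ →
        des (σ ▹ p) ≡ des σ ℕ.+ 𝟙 (code σ <ᵇ suc m ∸ toℕ p)
des-▹ {m} σ p σ! = ≡.trans (∣∣-fold (Des (σ ▹ p))) (≡.trans (Eℕ.fold-Des-▹ σ p σ! (λ _ → 1))
  (≡.cong (ℕ._+ 𝟙 (code σ <ᵇ suc m ∸ toℕ p)) (≡.sym (∣∣-fold (Des σ)))))

maj-▹ : ∀ {m} (σ : Word (suc m)) p → Unique σ →
        maj (σ ▹ p) ≡ maj σ ℕ.+ (if code σ <ᵇ suc m ∸ toℕ p then suc m else 0)
maj-▹ {m} σ p σ! = begin
  maj (σ ▹ p)
    ≡⟨ maj-fold (σ ▹ p) ⟩
  Σℕ.fold (elements (Des (σ ▹ p))) index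
    ≡⟨ Eℕ.fold-Des-▹ σ p σ! index ⟩
  Σℕ.fold (elements (Des σ)) (index ∘ inject₁) ℕ.+ (if b then index (fromℕ m) else 0)
    ≡⟨ ≡.cong₂ ℕ._+_ (Σℕ.fold-cong (elements (Des σ)) (λ i → ≡.cong suc (Fin.toℕ-inject₁ i)))
         (≡.cong (λ k → if b then suc k else 0) (Fin.toℕ-fromℕ m)) ⟩
  Σℕ.fold (elements (Des σ)) index ℕ.+ (if b then suc m else 0)
    ≡⟨ ≡.cong (ℕ._+ (if b then suc m else 0)) (maj-fold σ) ⟨
  maj σ ℕ.+ (if b then suc m else 0) ∎
  where
  open ≡.≡-Reasoning
  b = code σ <ᵇ suc m ∸ toℕ p

-- Weighted sums over permutations by transfer matrices.

module WordSums (𝓐 : LaurentAlgebra) where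

  open LaurentAlgebra 𝓐
  open Recurrences 𝓐
  open SemiringSolver commutativeSemiring using (solve; _:=_; _:+_; _:*_; con)
  open import Relation.Binary.Reasoning.Setoid setoid
  open FiniteSum +-commutativeMonoid
  open RingSum commutativeRing
  module ΠE = ElementSum *-commutativeMonoid

  fold-foldTo-comm : ∀ {A : Set} (xs : List A) n (f : A → ℕ → Carrier) →
                     fold xs (λ x → foldTo n (f x)) ≈ foldTo n (λ k → fold xs (λ x → f x k))
  fold-foldTo-comm xs zero    f = fold-ε xs
  fold-foldTo-comm xs (suc n) f = trans (fold-∙ xs _ _) (+-congʳ (fold-foldTo-comm xs n f))

  -- The appended letter `p` has code entry `n - p`, so reversing the sum over letters turns it into
  -- a sum over code entries.
  fold-𝔖-suc : ∀ n (F : Word (suc n) → Carrier) (G : Word n → ℕ → Carrier) →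
               (∀ σ p → Unique σ → F (σ ▹ p) ≈ G σ (n ∸ toℕ p)) →
               fold (𝔖 (suc n)) F ≈ fold (𝔖 n) (λ σ → foldTo (suc n) (G σ))
  fold-𝔖-suc n F G F≈G = begin
    fold (𝔖 (suc n)) F
      ≈⟨ fold-↭ F (𝔖-suc-↭ n) ⟩
    fold (cartesianProductWith _▹_ (𝔖 n) (allFin (suc n))) F
      ≈⟨ fold-product _▹_ (𝔖 n) (allFin (suc n)) F ⟩
    fold (𝔖 n) (λ σ → fold (allFin (suc n)) (λ p → F (σ ▹ p)))
      ≈⟨ fold-cong-∈ (𝔖 n) (λ {σ} σ∈𝔖 → begin
        fold (allFin (suc n)) (λ p → F (σ ▹ p))            ≈⟨ fold-cong (allFin (suc n)) (λ p → F≈G σ p (∈-𝔖⁻ σ∈𝔖)) ⟩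
        fold (allFin (suc n)) (λ p → G σ (n ∸ toℕ p))      ≡⟨ fold-allFin (suc n) _ ⟩
        sum {suc n} (λ p → G σ (n ∸ toℕ p))                ≈⟨ sum-toℕ (suc n) (λ k → G σ (n ∸ k)) ⟩
        foldTo (suc n) (λ k → G σ (n ∸ k))                 ≈⟨ foldTo-reverse n (G σ) ⟩
        foldTo (suc n) (G σ)                               ∎) ⟩
    fold (𝔖 n) (λ σ → foldTo (suc n) (G σ)) ∎

  -- The transfer-matrix method, with the last entry of the Lehmer code as
  -- the state and a parameter s that may increase when a letter is appended.
  module Transfer
    (T₀ T₁ : ℕ → ℕ → ℕ → Carrier)
    (A : ℕ → ℕ → ℕ → Carrier)
    (A-suc : ∀ s n c → A s (suc n) c ≈ foldTo (suc n) (λ c′ → A s n c′ * T₀ n c′ c + A (suc s) n c′ * T₁ n c′ c))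
    (w : ℕ → ∀ {m} → Word (suc m) → Carrier)
    (w-zero : ∀ s → w s (zero ∷ []) ≈ A s 0 0)
    (w-▹ : ∀ s {m} (σ : Word (suc m)) p → Unique σ →
           w s (σ ▹ p) ≈ w s σ * T₀ m (code σ) (suc m ∸ toℕ p) + w (suc s) σ * T₁ m (code σ) (suc m ∸ toℕ p))
    where

    -- An arbitrary function `g` of the last entry makes the induction close: for fixed `c`, the
    -- kernels `T₀ m c′ c` and `T₁ m c′ c` are again such functions of `c′`.
    refined : ∀ s m (g : ℕ → Carrier) →
              fold (𝔖 (suc m)) (λ σ → w s σ * g (code σ)) ≈ foldTo (suc m) (λ c → A s m c * g c)
    refined s zero    g = trans (+-congʳ (*-congʳ (w-zero s))) (+-comm _ _)
    refined s (suc m) g = begin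
      fold (𝔖 (suc (suc m))) (λ σ → w s σ * g (code σ))
        ≈⟨ fold-𝔖-suc (suc m) _ (λ σ c → (w s σ * T₀ m (code σ) c + w (suc s) σ * T₁ m (code σ) c) * g c)
             (λ σ p σ! → *-cong (w-▹ s σ p σ!) (reflexive (≡.cong g (inv□-▹-fromℕ σ p σ!)))) ⟩
      fold (𝔖 (suc m)) (λ σ → foldTo (suc (suc m)) (λ c →
          (w s σ * T₀ m (code σ) c + w (suc s) σ * T₁ m (code σ) c) * g c))
        ≈⟨ fold-foldTo-comm (𝔖 (suc m)) (suc (suc m)) _ ⟩
      foldTo (suc (suc m)) (λ c → fold (𝔖 (suc m)) (λ σ →
          (w s σ * T₀ m (code σ) c + w (suc s) σ * T₁ m (code σ) c) * g c))
        ≈⟨ foldTo-cong (suc (suc m)) (λ {c} _ → state c) ⟩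
      foldTo (suc (suc m)) (λ c → A s (suc m) c * g c) ∎
      where
      state : ∀ c → fold (𝔖 (suc m)) (λ σ → (w s σ * T₀ m (code σ) c + w (suc s) σ * T₁ m (code σ) c) * g c)
                    ≈ A s (suc m) c * g c
      state c = begin
        fold (𝔖 (suc m)) (λ σ → (w s σ * T₀ m (code σ) c + w (suc s) σ * T₁ m (code σ) c) * g c)
          ≈⟨ *-distribʳ-fold (g c) (𝔖 (suc m)) _ ⟨
        fold (𝔖 (suc m)) (λ σ → w s σ * T₀ m (code σ) c + w (suc s) σ * T₁ m (code σ) c) * g c
          ≈⟨ *-congʳ (begin
            fold (𝔖 (suc m)) (λ σ → w s σ * T₀ m (code σ) c + w (suc s) σ * T₁ m (code σ) c)
              ≈⟨ fold-∙ (𝔖 (suc m)) _ _ ⟩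
            fold (𝔖 (suc m)) (λ σ → w s σ * T₀ m (code σ) c) + fold (𝔖 (suc m)) (λ σ → w (suc s) σ * T₁ m (code σ) c)
              ≈⟨ +-cong (refined s m (λ c′ → T₀ m c′ c)) (refined (suc s) m (λ c′ → T₁ m c′ c)) ⟩
            foldTo (suc m) (λ c′ → A s m c′ * T₀ m c′ c) + foldTo (suc m) (λ c′ → A (suc s) m c′ * T₁ m c′ c)
              ≈⟨ foldTo-∙ (suc m) _ _ ⟨
            foldTo (suc m) (λ c′ → A s m c′ * T₀ m c′ c + A (suc s) m c′ * T₁ m c′ c)
              ≈⟨ A-suc s m c ⟨
            A s (suc m) c ∎) ⟩
        A s (suc m) c * g c ∎

    total : ∀ s m → fold (𝔖 (suc m)) (w s) ≈ foldTo (suc m) (A s m)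
    total s m = begin
      fold (𝔖 (suc m)) (w s)                  ≈⟨ fold-cong (𝔖 (suc m)) (λ σ → sym (*-identityʳ (w s σ))) ⟩
      fold (𝔖 (suc m)) (λ σ → w s σ * 1#)     ≈⟨ refined s m (λ _ → 1#) ⟩
      foldTo (suc m) (λ c → A s m c * 1#)     ≈⟨ foldTo-cong (suc m) (λ _ → *-identityʳ _) ⟩
      foldTo (suc m) (A s m)                  ∎

  ifᴿ : Bool → Carrier → Carrier
  ifᴿ b x = if b then x else 1#

  weightDes weightAsc : ∀ {n} → Word n → Carrier
  weightDes σ = Q (+ inv σ) * Π.fold (elements (Des σ)) (λ j → 1# + ζ (1 ℕ.+ inv□ (here j) σ))
  weightAsc σ = Q (+ inv σ) * Π.fold (elements (Asc σ)) (λ j → 1# + ζ (inv□ (next j) σ))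

  weightMaj : ℕ → ∀ {n} → Word n → Carrier
  weightMaj s σ = Q (+ maj σ) * ζ! (s ℕ.+ des σ)

  Q-inv-▹ : ∀ {n} (σ : Word n) p → Unique σ → Q (+ inv (σ ▹ p)) ≈ Q (+ inv σ) * Q (+ (n ∸ toℕ p))
  Q-inv-▹ {n} σ p σ! = trans (reflexive (≡.cong (Q ∘ +_) (inv-▹ σ p σ!))) (Q-+ (+ inv σ) (+ (n ∸ toℕ p)))

  -- A new descent sits at the old last position, so its factor uses the previous entry `code σ`.
  weightDes-▹ : ∀ {m} (σ : Word (suc m)) p → Unique σ → let c = suc m ∸ toℕ p in
                weightDes (σ ▹ p) ≈ weightDes σ * (Q (+ c) * (if code σ <ᵇ c then 1# + ζ (suc (code σ)) else 1#))
  weightDes-▹ {m} σ p σ! = begin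
    Q (+ inv (σ ▹ p)) * Π.fold (elements (Des (σ ▹ p))) (λ j → 1# + ζ (1 ℕ.+ inv□ (here j) (σ ▹ p)))
      ≈⟨ *-cong (Q-inv-▹ σ p σ!) (ΠE.fold-Des-▹ σ p σ! (λ j → 1# + ζ (1 ℕ.+ inv□ (here j) (σ ▹ p)))) ⟩
    (Q (+ inv σ) * Q (+ c)) * (Π.fold (elements (Des σ)) (λ j → 1# + ζ (1 ℕ.+ inv□ (inject₁ (inject₁ j)) (σ ▹ p)))
      * ifᴿ b (1# + ζ (1 ℕ.+ inv□ (inject₁ (fromℕ m)) (σ ▹ p))))
      ≈⟨ *-congˡ (*-cong
           (Π.fold-cong (elements (Des σ)) (λ j → reflexive (≡.cong (λ k → 1# + ζ (suc k)) (inv□-▹-inject₁ σ p (inject₁ j)))))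
           (reflexive (≡.cong (λ k → ifᴿ b (1# + ζ (suc k))) (inv□-▹-inject₁ σ p (fromℕ m))))) ⟩
    (Q (+ inv σ) * Q (+ c)) * (Π.fold (elements (Des σ)) (λ j → 1# + ζ (1 ℕ.+ inv□ (inject₁ j) σ))
      * ifᴿ b (1# + ζ (1 ℕ.+ code σ)))
      ≈⟨ solve 4 (λ x y u v → (x :* y) :* (u :* v) := (x :* u) :* (y :* v)) refl _ _ _ _ ⟩
    weightDes σ * (Q (+ c) * ifᴿ b (1# + ζ (suc (code σ)))) ∎
    where
    c = suc m ∸ toℕ p
    b = code σ <ᵇ c

  -- The factor of an ascent reads the code one position later, here at the appended letter, so it
  -- uses the new entry.
  weightAsc-▹ : ∀ {m} (σ : Word (suc m)) p → Unique σ → let c = suc m ∸ toℕ p in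
                weightAsc (σ ▹ p) ≈ weightAsc σ * (Q (+ c) * (if code σ <ᵇ c then 1# else 1# + ζ c))
  weightAsc-▹ {m} σ p σ! = begin
    Q (+ inv (σ ▹ p)) * Π.fold (elements (Asc (σ ▹ p))) (λ j → 1# + ζ (inv□ (next j) (σ ▹ p)))
      ≈⟨ *-cong (Q-inv-▹ σ p σ!) (ΠE.fold-Asc-▹ σ p σ! (λ j → 1# + ζ (inv□ (next j) (σ ▹ p)))) ⟩
    (Q (+ inv σ) * Q (+ c)) * (Π.fold (elements (Asc σ)) (λ j → 1# + ζ (inv□ (inject₁ (suc j)) (σ ▹ p)))
      * ifᴿ (not b) (1# + ζ (inv□ (fromℕ (suc m)) (σ ▹ p))))
      ≈⟨ *-congˡ (*-cong
           (Π.fold-cong (elements (Asc σ)) (λ j → reflexive (≡.cong (λ k → 1# + ζ k) (inv□-▹-inject₁ σ p (suc j)))))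
           (trans (reflexive (≡.cong (λ k → ifᴿ (not b) (1# + ζ k)) (inv□-▹-fromℕ σ p σ!))) (if-not b))) ⟩
    (Q (+ inv σ) * Q (+ c)) * (Π.fold (elements (Asc σ)) (λ j → 1# + ζ (inv□ (suc j) σ))
      * (if b then 1# else 1# + ζ c))
      ≈⟨ solve 4 (λ x y u v → (x :* y) :* (u :* v) := (x :* u) :* (y :* v)) refl _ _ _ _ ⟩
    weightAsc σ * (Q (+ c) * (if b then 1# else 1# + ζ c)) ∎
    where
    c = suc m ∸ toℕ p
    b = code σ <ᵇ c
    if-not : ∀ b {x} → ifᴿ (not b) x ≈ (if b then 1# else x)
    if-not true  = refl
    if-not false = refl

  weightMaj-▹ : ∀ s {m} (σ : Word (suc m)) p → Unique σ → let b = code σ <ᵇ suc m ∸ toℕ p in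
                weightMaj s (σ ▹ p) ≈ weightMaj s σ * (if b then 0# else 1#)
                                      + weightMaj (suc s) σ * (if b then Q (+ suc m) else 0#)
  weightMaj-▹ s {m} σ p σ! rewrite maj-▹ σ p σ! | des-▹ σ p σ! with code σ <ᵇ suc m ∸ toℕ p
  -- A descent at position m + 1 adds m + 1 to `maj`; the extra descent is absorbed by `s`, as s +
  -- (des + 1) = (s + 1) + des.
  ... | true rewrite ℕ.+-comm (des σ) 1 | ℕ.+-suc s (des σ) = begin
    Q (+ (maj σ ℕ.+ suc m)) * f              ≈⟨ *-congʳ (Q-+ (+ maj σ) (+ suc m)) ⟩
    (Q (+ maj σ) * Q (+ suc m)) * f
      ≈⟨ solve 4 (λ x y t w → (x :* y) :* t := w :* con 0 :+ (x :* t) :* y) refl _ _ _ _ ⟩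
    weightMaj s σ * 0# + (Q (+ maj σ) * f) * Q (+ suc m) ∎
    where f = ζ! (suc (s ℕ.+ des σ))
  ... | false rewrite ℕ.+-identityʳ (maj σ) | ℕ.+-identityʳ (des σ) =
    solve 2 (λ x w → x := x :* con 1 :+ w :* con 0) refl _ _

  ∑weightDes≈∑codeSum : ∀ m → fold (𝔖 (suc m)) weightDes ≈ foldTo (suc m) (codeSum m)
  ∑weightDes≈∑codeSum m = trans (Transfer.total
    (λ n c′ c → Q (+ c) * (if c′ <ᵇ c then 1# + ζ (suc c′) else 1#)) (λ _ _ _ → 0#)
    (λ _ → codeDes) (λ _ n c → trans (*-distribˡ-foldTo (Q (+ c)) (suc n) _) (foldTo-cong (suc n) (λ {c′} _ → kernel n c c′)))
    (λ _ → weightDes) (λ _ → trans (*-identityʳ _) Q-0)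
    (λ _ σ p σ! → trans (weightDes-▹ σ p σ!) (sym (trans (+-congˡ (zeroʳ _)) (+-identityʳ _))))
    0 m) (foldTo-cong (suc m) (λ { (s≤s c≤m) → codeDes≈codeSum m _ c≤m }))
    where
    kernel : ∀ n c c′ → Q (+ c) * select c (λ c′ → codeDes n c′ * (1# + ζ (suc c′))) (codeDes n) c′
                        ≈ codeDes n c′ * (Q (+ c) * (if c′ <ᵇ c then 1# + ζ (suc c′) else 1#)) + codeDes n c′ * 0#
    kernel n c c′ with c′ <ᵇ c
    ... | true  = solve 3 (λ x d t → x :* (d :* t) := d :* (x :* t) :+ d :* con 0) refl _ _ _
    ... | false = solve 2 (λ x d → x :* d := d :* (x :* con 1) :+ d :* con 0) refl _ _

  ∑weightAsc≈∑codeSum : ∀ m → fold (𝔖 (suc m)) weightAsc ≈ foldTo (suc m) (codeSum m)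
  ∑weightAsc≈∑codeSum m = trans (Transfer.total
    (λ n c′ c → Q (+ c) * (if c′ <ᵇ c then 1# else 1# + ζ c)) (λ _ _ _ → 0#)
    (λ _ → codeAsc) (λ _ n c → trans (*-distribˡ-foldTo (Q (+ c)) (suc n) _) (foldTo-cong (suc n) (λ {c′} _ → kernel n c c′)))
    (λ _ → weightAsc) (λ _ → trans (*-identityʳ _) Q-0)
    (λ _ σ p σ! → trans (weightAsc-▹ σ p σ!) (sym (trans (+-congˡ (zeroʳ _)) (+-identityʳ _))))
    0 m) (∑codeAsc≈∑codeSum m)
    where
    kernel : ∀ n c c′ → Q (+ c) * select c (codeAsc n) (λ c′ → codeAsc n c′ * (1# + ζ c)) c′
                        ≈ codeAsc n c′ * (Q (+ c) * (if c′ <ᵇ c then 1# else 1# + ζ c)) + codeAsc n c′ * 0#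
    kernel n c c′ with c′ <ᵇ c
    ... | false = solve 3 (λ x d t → x :* (d :* t) := d :* (x :* t) :+ d :* con 0) refl _ _ _
    ... | true  = solve 2 (λ x d → x :* d := d :* (x :* con 1) :+ d :* con 0) refl _ _

  ∑weightMaj≈∑codeSum : ∀ m → fold (𝔖 (suc m)) (weightMaj 0) ≈ foldTo (suc m) (codeSum m)
  ∑weightMaj≈∑codeSum m = trans (Transfer.total
    (λ n c′ c → if c′ <ᵇ c then 0# else 1#) (λ n c′ c → if c′ <ᵇ c then Q (+ suc n) else 0#)
    codeMaj (λ s n c → foldTo-cong (suc n) (λ {c′} _ → kernel s n c c′))
    (λ s → weightMaj s) (λ s → trans (*-cong Q-0 (reflexive (≡.cong ζ! (ℕ.+-identityʳ s)))) (*-identityˡ _))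
    weightMaj-▹ 0 m) (foldTo-cong (suc m) (λ { (s≤s c≤m) → codeMaj≈codeSum m _ c≤m }))
    where
    kernel : ∀ s n c c′ → select c (λ c′ → Q (+ suc n) * codeMaj (suc s) n c′) (codeMaj s n) c′
                          ≈ codeMaj s n c′ * (if c′ <ᵇ c then 0# else 1#) + codeMaj (suc s) n c′ * (if c′ <ᵇ c then Q (+ suc n) else 0#)
    kernel s n c c′ with c′ <ᵇ c
    ... | true  = solve 3 (λ x d t → x :* d := t :* con 0 :+ d :* x) refl _ _ _
    ... | false = solve 2 (λ x d → x := x :* con 1 :+ d :* con 0) refl _ _

-- Descent-starred permutations

module StarredSums (𝓐 : LaurentAlgebra) where

  open LaurentAlgebra 𝓐
  open Recurrences 𝓐
  open WordSums 𝓐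
  open SemiringSolver commutativeSemiring using (solve; _:=_; _:+_; _:*_; con)
  open import Relation.Binary.Reasoning.Setoid setoid
  open FiniteSum +-commutativeMonoid
  open RingSum commutativeRing
  open Exp semiring using (_^_)

  subsets : ∀ m → List (Subset m)
  subsets = words (outside ∷ inside ∷ [])

  -- Expansion of a product of binomials, by deciding for the first position whether it belongs to
  -- `S`.
  fold-subsets-sum : ∀ {m} (D : Subset m) (a : Fin m → Carrier) →
    fold (subsets m) (λ S → if does (S ⊆? D) then Π.sum (λ i → ifᴿ (lookup S i) (a i)) else 0#)
    ≈ Π.sum (λ i → ifᴿ (lookup D i) (1# + a i))
  fold-subsets-sum {zero}  []      a = +-identityʳ _
  fold-subsets-sum {suc m} (d ∷ D) a = trans (fold-product _∷_ (outside ∷ inside ∷ []) (subsets m)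
    (λ S → if does (S ⊆? (d ∷ D)) then Π.sum (λ i → ifᴿ (lookup S i) (a i)) else 0#)) (cons d)
    where
    F = λ S → if does (S ⊆? D) then Π.sum (λ i → ifᴿ (lookup S i) (a (suc i))) else 0#
    scale : ∀ x → fold (subsets m) (λ S → if does (S ⊆? D) then x * Π.sum (λ i → ifᴿ (lookup S i) (a (suc i))) else 0#)
                  ≈ x * fold (subsets m) F
    scale x = trans (fold-cong (subsets m) pull) (sym (*-distribˡ-fold x (subsets m) F))
      where
      pull : ∀ S → (if does (S ⊆? D) then x * Π.sum (λ i → ifᴿ (lookup S i) (a (suc i))) else 0#) ≈ x * F S
      pull S with does (S ⊆? D)
      ... | true  = refl
      ... | false = sym (zeroʳ x)
    cons : ∀ d →
      fold (subsets m) (λ S → if does ((outside ∷ S) ⊆? (d ∷ D)) then 1# * Π.sum (λ i → ifᴿ (lookup S i) (a (suc i))) else 0#)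
      + (fold (subsets m) (λ S → if does ((inside ∷ S) ⊆? (d ∷ D)) then a zero * Π.sum (λ i → ifᴿ (lookup S i) (a (suc i))) else 0#) + 0#)
      ≈ ifᴿ d (1# + a zero) * Π.sum (λ i → ifᴿ (lookup D i) (1# + a (suc i)))
    cons outside = begin
      -- A set containing the first position is not contained in `outside ∷ D`, so the second sum
      -- consists of zeros.
      _ + (_ + 0#)                                          ≈⟨ +-cong (scale 1#) (+-congʳ (fold-ε (subsets m))) ⟩
      1# * fold (subsets m) F + (0# + 0#)                   ≈⟨ trans (+-congˡ (+-identityʳ 0#)) (+-identityʳ _) ⟩
      1# * fold (subsets m) F                               ≈⟨ *-congˡ (fold-subsets-sum D (a ∘ suc)) ⟩
      1# * Π.sum (λ i → ifᴿ (lookup D i) (1# + a (suc i)))  ∎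
    cons inside = begin
      _ + (_ + 0#)                     ≈⟨ +-cong (scale 1#) (+-congʳ (scale (a zero))) ⟩
      1# * fold (subsets m) F + (a zero * fold (subsets m) F + 0#)
        ≈⟨ solve 2 (λ x y → con 1 :* y :+ (x :* y :+ con 0) := (con 1 :+ x) :* y) refl _ _ ⟩
      (1# + a zero) * fold (subsets m) F ≈⟨ *-congˡ (fold-subsets-sum D (a ∘ suc)) ⟩
      (1# + a zero) * Π.sum (λ i → ifᴿ (lookup D i) (1# + a (suc i))) ∎

  fold-subsets : ∀ {m} (D : Subset m) (a : Fin m → Carrier) →
    fold (subsets m) (λ S → if does (S ⊆? D) then Π.fold (elements S) a else 0#)
    ≈ Π.fold (elements D) (λ i → 1# + a i)
  fold-subsets {m} D a = begin
    fold (subsets m) (λ S → if does (S ⊆? D) then Π.fold (elements S) a else 0#)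
      ≈⟨ fold-cong (subsets m) convert ⟩
    fold (subsets m) (λ S → if does (S ⊆? D) then Π.sum (λ i → ifᴿ (lookup S i) (a i)) else 0#)
      ≈⟨ fold-subsets-sum D a ⟩
    Π.sum (λ i → ifᴿ (lookup D i) (1# + a i))
      ≈⟨ ΠE.fold-elements D _ ⟨
    Π.fold (elements D) (λ i → 1# + a i) ∎
    where
    convert : ∀ S → (if does (S ⊆? D) then Π.fold (elements S) a else 0#)
                    ≈ (if does (S ⊆? D) then Π.sum (λ i → ifᴿ (lookup S i) (a i)) else 0#)
    convert S with does (S ⊆? D)
    ... | true  = ΠE.fold-elements S a
    ... | false = refl

  Q-neg-+ : ∀ a b → Q (- (+ (a ℕ.+ b))) ≈ Q (- (+ a)) * Q (- (+ b))
  Q-neg-+ a b = trans (reflexive (≡.cong Q (ℤ.neg-distrib-+ (+ a) (+ b)))) (Q-+ (- (+ a)) (- (+ b)))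

  Π-ζ : ∀ {A : Set} (xs : List A) (g : A → ℕ) →
        Q (- (+ listSum (map g xs))) * z ^ length xs ≈ Π.fold xs (ζ ∘ g)
  Π-ζ []       g = trans (*-identityʳ _) Q-0
  Π-ζ (x ∷ xs) g = begin
    Q (- (+ (g x ℕ.+ listSum (map g xs)))) * (z * z ^ length xs)
      ≈⟨ *-congʳ (Q-neg-+ (g x) (listSum (map g xs))) ⟩
    (Q (- (+ g x)) * Q (- (+ listSum (map g xs)))) * (z * z ^ length xs)
      ≈⟨ solve 4 (λ x y z w → (x :* y) :* (z :* w) := (x :* z) :* (y :* w)) refl _ _ _ _ ⟩
    ζ (g x) * (Q (- (+ listSum (map g xs))) * z ^ length xs)
      ≈⟨ *-congˡ (Π-ζ xs g) ⟩
    ζ (g x) * Π.fold xs (ζ ∘ g) ∎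

  foldTo-≟ : ∀ {n m} (f : ℕ → Carrier) → m < n →
             foldTo n (λ k → if does (m ℕ.≟ k) then f k else 0#) ≈ f m
  foldTo-≟ {suc n} {m} f (s≤s m≤n) with ℕ.m≤n⇒m<n∨m≡n m≤n
  ... | inj₁ m<n rewrite dec-false (m ℕ.≟ n) (ℕ.<⇒≢ m<n) = trans (+-identityʳ _) (foldTo-≟ f m<n)
  ... | inj₂ ≡.refl rewrite dec-true (m ℕ.≟ m) ≡.refl = trans (+-congʳ (trans
    (foldTo-cong m (λ {k} k<m → reflexive (≡.cong (if_then f k else 0#) (dec-false (m ℕ.≟ k) (ℕ.>⇒≢ k<m)))))
    (foldTo-ε m))) (+-identityˡ _)

  module _ m (st : Word (suc m) → ℕ) (g : Word (suc m) → Fin m → ℕ) where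

    private
      n = suc m

    st* : Word n × Subset m → ℤ
    st* (σ , S) = + st σ ℤ.- + listSum (map (g σ) (elements S))

    -- Both starred statistics subtract a sum over `S` of terms depending only on σ and the
    -- position. Hence the weight with z^|S| is a product over `S`, and summing over all `S` inside
    -- the descent set gives a product of binomials.
    fold-starred :
      foldTo n (λ k → fold (𝔖> n k) (Q ∘ st*) * z ^ k)
      ≈ fold (𝔖 n) (λ σ → Q (+ st σ) * Π.fold (elements (Des σ)) (λ i → 1# + ζ (g σ i)))
    fold-starred = begin
      foldTo n (λ k → fold (𝔖> n k) (Q ∘ st*) * z ^ k)
        ≈⟨ foldTo-cong n (λ {k} _ → fixed-size k) ⟩
      foldTo n (λ k → fold (𝔖 n) (λ σ → fold (subsets m) (λ S → term σ S k)))
        ≈⟨ fold-foldTo-comm (𝔖 n) n _ ⟨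
      fold (𝔖 n) (λ σ → foldTo n (λ k → fold (subsets m) (λ S → term σ S k)))
        ≈⟨ fold-cong (𝔖 n) (λ σ → sym (fold-foldTo-comm (subsets m) n (term σ))) ⟩
      fold (𝔖 n) (λ σ → fold (subsets m) (λ S → foldTo n (term σ S)))
        ≈⟨ fold-cong (𝔖 n) (λ σ → fold-cong (subsets m) (λ S → all-sizes σ S)) ⟩
      fold (𝔖 n) (λ σ → fold (subsets m) (λ S → Q (+ st σ) * (if does (S ⊆? Des σ) then Π.fold (elements S) (ζ ∘ g σ) else 0#)))
        ≈⟨ fold-cong (𝔖 n) (λ σ → trans (sym (*-distribˡ-fold (Q (+ st σ)) (subsets m) _))
             (*-congˡ (fold-subsets (Des σ) (ζ ∘ g σ)))) ⟩
      fold (𝔖 n) (λ σ → Q (+ st σ) * Π.fold (elements (Des σ)) (λ i → 1# + ζ (g σ i))) ∎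
      where
      term : Word n → Subset m → ℕ → Carrier
      term σ S k = (if does ((S ⊆? Des σ) ×-dec (∣ S ∣ ℕ.≟ k)) then Q (st* (σ , S)) else 0#) * z ^ k

      fixed-size : ∀ k → fold (𝔖> n k) (Q ∘ st*) * z ^ k
                         ≈ fold (𝔖 n) (λ σ → fold (subsets m) (λ S → term σ S k))
      fixed-size k = begin
        fold (𝔖> n k) (Q ∘ st*) * z ^ k
          ≈⟨ *-congʳ (fold-filter (λ (σ , S) → (S ⊆? Des σ) ×-dec (∣ S ∣ ℕ.≟ k)) (cartesianProduct (𝔖 n) (subsets m)) (Q ∘ st*)) ⟩
        fold (cartesianProduct (𝔖 n) (subsets m)) _ * z ^ k
          ≈⟨ *-distribʳ-fold (z ^ k) (cartesianProduct (𝔖 n) (subsets m)) _ ⟩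
        fold (cartesianProduct (𝔖 n) (subsets m)) (λ (σ , S) → term σ S k)
          ≈⟨ fold-product _,_ (𝔖 n) (subsets m) (λ (σ , S) → term σ S k) ⟩
        fold (𝔖 n) (λ σ → fold (subsets m) (λ S → term σ S k)) ∎

      all-sizes : ∀ σ S → foldTo n (term σ S)
                  ≈ Q (+ st σ) * (if does (S ⊆? Des σ) then Π.fold (elements S) (ζ ∘ g σ) else 0#)
      all-sizes σ S with does (S ⊆? Des σ)
      ... | false = trans (trans (foldTo-cong n (λ _ → zeroˡ _)) (foldTo-ε n)) (sym (zeroʳ _))
      ... | true  = begin
        foldTo n (λ k → (if does (∣ S ∣ ℕ.≟ k) then Q (st* (σ , S)) else 0#) * z ^ k)
          ≈⟨ foldTo-cong n (λ {k} _ → if-*ʳ (does (∣ S ∣ ℕ.≟ k)) _ _) ⟩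
        foldTo n (λ k → if does (∣ S ∣ ℕ.≟ k) then Q (st* (σ , S)) * z ^ k else 0#)
          -- A subset of m positions has at most m < n elements, so its size occurs exactly once in
          -- the range of k.
          ≈⟨ foldTo-≟ (λ k → Q (st* (σ , S)) * z ^ k) (s≤s (∣p∣≤n S)) ⟩
        Q (st* (σ , S)) * z ^ ∣ S ∣
          ≈⟨ *-cong (Q-+ (+ st σ) _) (reflexive (≡.cong (z ^_) (∣∣-length S))) ⟩
        (Q (+ st σ) * Q (- (+ listSum (map (g σ) (elements S))))) * z ^ length (elements S)
          ≈⟨ *-assoc _ _ _ ⟩
        Q (+ st σ) * (Q (- (+ listSum (map (g σ) (elements S)))) * z ^ length (elements S))
          ≈⟨ *-congˡ (Π-ζ (elements S) (g σ)) ⟩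
        Q (+ st σ) * Π.fold (elements S) (ζ ∘ g σ) ∎
        where
        if-*ʳ : ∀ b x y → (if b then x else 0#) * y ≈ (if b then x * y else 0#)
        if-*ʳ true  x y = refl
        if-*ʳ false x y = zeroˡ y

  from-zero : ∀ {m} (D : Subset (suc m)) → D ∩ from zero ≡ D
  from-zero D = ≡.trans (≡.cong (D ∩_) (from≡⊤ _)) (∩-identityʳ D)
    where
    from≡⊤ : ∀ m → tabulate {n = m} (λ _ → true) ≡ ⊤
    from≡⊤ zero    = ≡.refl
    from≡⊤ (suc m) = ≡.cong (true ∷_) (from≡⊤ m)

  ∣∩from-suc∣ : ∀ {m} d (D : Subset m) i → ∣ (d ∷ D) ∩ from (suc i) ∣ ≡ ∣ D ∩ from i ∣
  ∣∩from-suc∣ d D i = ≡.trans (drop d) (≡.cong (λ S → ∣ D ∩ S ∣)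
    (tabulate-cong (λ j → does-⇔ (mk⇔ (λ { (s≤s i≤j) → i≤j }) s≤s) (suc i Fin.≤? suc j) (i Fin.≤? j))))
    where
    drop : ∀ d {S} → ∣ (d ∷ D) ∩ (outside ∷ S) ∣ ≡ ∣ D ∩ S ∣
    drop inside  = ≡.refl
    drop outside = ≡.refl

  -- From left to right over the elements of `D`, the number of elements not yet passed, the current
  -- one included, runs through |D|, ..., 2, 1.
  Π-from : ∀ {m} (D : Subset m) → Π.fold (elements D) (λ i → 1# + ζ ∣ D ∩ from i ∣) ≈ ζ! ∣ D ∣
  Π-from D = trans (ΠE.fold-elements D _) (go D)
    where
    go : ∀ {m} (D : Subset m) → Π.sum (λ i → ifᴿ (lookup D i) (1# + ζ ∣ D ∩ from i ∣)) ≈ ζ! ∣ D ∣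
    tails : ∀ {m} d (D : Subset m) →
            Π.sum (λ i → ifᴿ (lookup D i) (1# + ζ ∣ (d ∷ D) ∩ from (suc i) ∣)) ≈ ζ! ∣ D ∣
    tails d D = trans (Π.sum-cong-≋ (λ i → reflexive
      (≡.cong (λ k → ifᴿ (lookup D i) (1# + ζ k)) (∣∩from-suc∣ d D i)))) (go D)
    go []            = refl
    go (outside ∷ D) = trans (*-identityˡ _) (tails outside D)
    -- The first element sees the whole set and gives the factor of largest index, which `ζ!` has at
    -- its right end; hence the commutation.
    go (inside  ∷ D) = trans (*-cong (reflexive (≡.cong (λ S → 1# + ζ ∣ S ∣) (from-zero (inside ∷ D)))) (tails inside D))
                             (*-comm _ _)

  fold-inv* : ∀ m → foldTo (suc m) (λ k → fold (𝔖> (suc m) k) (Q ∘ inv*) * z ^ k) ≈ fold (𝔖 (suc m)) weightDes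
  fold-inv* m = fold-starred m inv (λ σ i → 1 ℕ.+ inv□ (here i) σ)

  fold-maj* : ∀ m → foldTo (suc m) (λ k → fold (𝔖> (suc m) k) (Q ∘ maj*) * z ^ k) ≈ fold (𝔖 (suc m)) (weightMaj 0)
  fold-maj* m = trans (fold-starred m maj (λ σ i → ∣ Des σ ∩ from i ∣))
    (fold-cong (𝔖 (suc m)) (λ σ → *-congˡ (Π-from (Des σ))))

-- Polynomials in z over Laurent polynomials in q

laurentRing : CommutativeRing 0ℓ 0ℓ
laurentRing = MonoidRingProperties.monoidRing ℤ.+-*-rawRing ℤ.+-*-isCommutativeRing
  ℤ._+_ (+ 0) ℤ._≟_ ℤ.+-0-isCommutativeMonoid

module L = CommutativeRing laurentRing

-- `mono c k` stands for c z^k. These laws are all that the final comparison uses about how Laurent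
-- coefficients and powers of z sit in the polynomial ring.
record GradedHomomorphism : Set₁ where
  field
    commutativeRing : CommutativeRing 0ℓ 0ℓ
  open CommutativeRing commutativeRing public hiding (-_; zero)
  field
    mono      : Laurent → ℕ → Carrier
    mono-cong : ∀ {c d} k → c L.≈ d → mono c k ≈ mono d k
    mono-0    : ∀ k → mono 0ᴸ k ≈ 0#
    mono-+    : ∀ c d k → mono (c +ᴸ d) k ≈ mono c k + mono d k
    mono-1    : mono 1ᴸ 0 ≈ 1#
    mono-*    : ∀ c d j k → mono (c *ᴸ d) (j ℕ.+ k) ≈ mono c j * mono d k

  laurentAlgebra : LaurentAlgebra
  laurentAlgebra = record
    { commutativeRing = commutativeRing
    ; Q   = λ a → mono (q^ a) 0
    ; Q-+ = λ a b → mono-* (q^ a) (q^ b) 0 0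
    ; Q-0 = mono-1
    ; z   = mono 1ᴸ 1
    }

module GradedSums (𝓗 : GradedHomomorphism) where

  open GradedHomomorphism 𝓗
  open LaurentAlgebra laurentAlgebra using (Q; z)
  open Recurrences laurentAlgebra
  open WordSums laurentAlgebra
  open StarredSums laurentAlgebra
  open SemiringSolver commutativeSemiring using (solve; _:=_; _:+_; _:*_; con)
  open import Relation.Binary.Reasoning.Setoid setoid
  open FiniteSum +-commutativeMonoid
  open Exp semiring using (_^_)

  ι : Laurent → Carrier
  ι c = mono c 0

  mono-ι : ∀ c k → mono c k ≈ ι c * z ^ k
  mono-ι c zero    = sym (*-identityʳ _)
  mono-ι c (suc k) = begin
    mono c (suc k)            ≈⟨ mono-cong (suc k) (L.*-identityˡ c) ⟨
    mono (1ᴸ *ᴸ c) (1 ℕ.+ k)  ≈⟨ mono-* 1ᴸ c 1 k ⟩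
    z * mono c k              ≈⟨ *-congˡ (mono-ι c k) ⟩
    z * (ι c * z ^ k)         ≈⟨ solve 3 (λ z c w → z :* (c :* w) := c :* (z :* w)) refl _ _ _ ⟩
    ι c * (z * z ^ k)         ∎

  mono-ζ : ∀ k → mono (q^ (- (+ k))) 1 ≈ ζ k
  mono-ζ k = trans (mono-ι _ 1) (*-congˡ (*-identityʳ z))

  ι-∑ : ∀ {A : Set} (xs : List A) f → ι (∑ᴸ xs f) ≈ fold xs (ι ∘ f)
  ι-∑ []       f = mono-0 0
  ι-∑ (x ∷ xs) f = trans (mono-+ (f x) _ 0) (+-congˡ (ι-∑ xs f))

  ι-∏ : ∀ {A : Set} (xs : List A) f → ι (∏ᴸ xs f) ≈ Π.fold xs (ι ∘ f)
  ι-∏ []       f = mono-1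
  ι-∏ (x ∷ xs) f = trans (mono-* (f x) _ 0 0) (*-congˡ (ι-∏ xs f))

  ι-qnum : ∀ k → ι [ k ]q ≈ qnum k
  ι-qnum k = trans (ι-∑ (upTo k) (λ i → q^ (+ i))) (fold-applyUpTo id k _)

  ι-qfact : ∀ k → ι [ k ]q! ≈ qfact k
  ι-qfact k = trans (ι-∏ (applyUpTo suc k) [_]q)
    (trans (Π.fold-applyUpTo suc k _) (Π.foldTo-cong k (λ {i} _ → ι-qnum (suc i))))

  ι-qStirling-suc : ∀ n k →
    ι (qStirling (suc n) (suc k)) ≈ ι (qStirling n k) + qnum (suc k) * ι (qStirling n (suc k))
  ι-qStirling-suc n k = trans (mono-+ _ _ 0) (+-congˡ (trans (mono-* _ _ 0 0) (*-congʳ (ι-qnum (suc k)))))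

  ι-qStirling-zero : ∀ {n k} → n < k → ι (qStirling n k) ≈ 0#
  ι-qStirling-zero {zero}  {suc k} _         = mono-0 0
  ι-qStirling-zero {suc n} {suc k} (s≤s n<k) = begin
    ι (qStirling (suc n) (suc k))                               ≈⟨ ι-qStirling-suc n k ⟩
    ι (qStirling n k) + qnum (suc k) * ι (qStirling n (suc k))
      ≈⟨ +-cong (ι-qStirling-zero n<k) (*-congˡ (ι-qStirling-zero (ℕ.m<n⇒m<1+n n<k))) ⟩
    0# + qnum (suc k) * 0#                                        ≈⟨ trans (+-identityˡ _) (zeroʳ _) ⟩
    0#                                                          ∎

  -- Multiplication by x in the chosen basis is the q-Stirling recurrence, with one z for every
  -- factor [k].
  x^≈qStirling : ∀ n k → x^ n k ≈ ι (qStirling n k) * z ^ (n ∸ k)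
  x^≈qStirling zero    zero    = sym (trans (*-identityʳ _) mono-1)
  x^≈qStirling zero    (suc k) = sym (trans (*-identityʳ _) (mono-0 0))
  -- `[ 0 ]q` is the empty list, so this q-Stirling number computes to `0ᴸ`.
  x^≈qStirling (suc n) zero    = sym (trans (*-congʳ (mono-0 0)) (zeroˡ _))
  x^≈qStirling (suc n) (suc k) = begin
    x^ n k + z * (b * x^ n (suc k))
      ≈⟨ +-cong (x^≈qStirling n k) (*-congˡ (*-congˡ (x^≈qStirling n (suc k)))) ⟩
    ι (qStirling n k) * z ^ (n ∸ k) + z * (b * (S′ * z ^ (n ∸ suc k)))
      ≈⟨ +-congˡ (solve 4 (λ z b t w → z :* (b :* (t :* w)) := b :* (t :* (z :* w))) refl _ _ _ _) ⟩
    ι (qStirling n k) * z ^ (n ∸ k) + b * (S′ * (z * z ^ (n ∸ suc k)))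
      ≈⟨ +-congˡ (*-congˡ degree) ⟩
    ι (qStirling n k) * z ^ (n ∸ k) + b * (S′ * z ^ (n ∸ k))
      ≈⟨ solve 4 (λ t w b u → t :* w :+ b :* (u :* w) := (t :+ b :* u) :* w) refl _ _ _ _ ⟩
    (ι (qStirling n k) + b * S′) * z ^ (n ∸ k)
      ≈⟨ *-congʳ (ι-qStirling-suc n k) ⟨
    ι (qStirling (suc n) (suc k)) * z ^ (n ∸ k) ∎
    where
    b = qnum (suc k)
    S′ = ι (qStirling n (suc k))
    -- For k ≥ n the truncated differences break the exponent count, but then the q-Stirling number
    -- `S′` represents vanishes.
    degree : S′ * (z * z ^ (n ∸ suc k)) ≈ S′ * z ^ (n ∸ k)
    degree with ℕ.<-≤-connex k n
    ... | inj₁ k<n = *-congˡ (reflexive (≡.cong (z ^_) (≡.sym (ℕ.+-∸-assoc 1 k<n))))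
    ... | inj₂ n≤k = trans (trans (*-congʳ S′≈0) (zeroˡ _)) (sym (trans (*-congʳ S′≈0) (zeroˡ _)))
      where S′≈0 = ι-qStirling-zero {n} (s≤s n≤k)

  module _ (m : ℕ) where

    private
      n = suc m

    starred-fold : (st* : Word n × Subset m → ℤ) →
      fold (upTo n) (λ k → mono (∑ᴸ (𝔖> n k) (q^ ∘ st*)) k) ≈ foldTo n (λ k → fold (𝔖> n k) (Q ∘ st*) * z ^ k)
    starred-fold st* = trans (fold-applyUpTo id n _)
      (foldTo-cong n (λ {k} _ → trans (mono-ι _ k) (*-congʳ (ι-∑ (𝔖> n k) _))))

    invStarred≈ :
      fold (upTo n) (λ k → mono (∑ᴸ (𝔖> n k) (λ σS → q^ (inv* σS))) k) ≈ foldTo n (codeSum m)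
    invStarred≈ = trans (starred-fold inv*) (trans (fold-inv* m) (∑weightDes≈∑codeSum m))

    majStarred≈ :
      fold (upTo n) (λ k → mono (∑ᴸ (𝔖> n k) (λ σS → q^ (maj* σS))) k) ≈ foldTo n (codeSum m)
    majStarred≈ = trans (starred-fold maj*) (trans (fold-maj* m) (∑weightMaj≈∑codeSum m))

    stirling≈ :
      fold (applyUpTo suc n) (λ k → mono ([ k ]q! *ᴸ qStirling n k) (n ∸ k)) ≈ foldTo n (codeSum m)
    stirling≈ = begin
      fold (applyUpTo suc n) (λ k → mono ([ k ]q! *ᴸ qStirling n k) (n ∸ k))
        ≈⟨ fold-applyUpTo suc n _ ⟩
      foldTo n (λ k → mono ([ suc k ]q! *ᴸ qStirling n (suc k)) (m ∸ k))
        ≈⟨ foldTo-cong n (λ {k} _ → trans (mono-ι _ (m ∸ k)) (trans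
             (*-congʳ (trans (mono-* [ suc k ]q! (qStirling n (suc k)) 0 0) (*-congʳ (ι-qfact (suc k)))))
             (trans (*-assoc _ _ _) (*-congˡ (sym (x^≈qStirling n (suc k))))))) ⟩
      foldTo n (λ k → qfact (suc k) * x^ n (suc k))
        ≈⟨ ∑codeSum≈stirling m ⟨
      foldTo n (codeSum m) ∎

    invDes≈ : fold (𝔖 n) (λ σ → Q (+ inv σ) *
                Π.fold (elements (Des σ)) (λ j → 1# + mono (q^ (- (+ (1 ℕ.+ inv□ (here j) σ)))) 1))
              ≈ foldTo n (codeSum m)
    invDes≈ = trans (fold-cong (𝔖 n) (λ σ → *-congˡ (Π.fold-cong (elements (Des σ)) (λ j →
      +-congˡ (mono-ζ (1 ℕ.+ inv□ (here j) σ)))))) (∑weightDes≈∑codeSum m)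

    invAsc≈ : fold (𝔖 n) (λ σ → Q (+ inv σ) *
                Π.fold (elements (Asc σ)) (λ j → 1# + mono (q^ (- (+ inv□ (next j) σ))) 1))
              ≈ foldTo n (codeSum m)
    invAsc≈ = trans (fold-cong (𝔖 n) (λ σ → *-congˡ (Π.fold-cong (elements (Asc σ)) (λ j →
      +-congˡ (mono-ζ (inv□ (next j) σ)))))) (∑weightAsc≈∑codeSum m)

    majDes≈ : fold (𝔖 n) (λ σ → Q (+ maj σ) *
                Π.fold (applyUpTo suc (des σ)) (λ j → 1# + mono (q^ (- (+ j))) 1))
              ≈ foldTo n (codeSum m)
    majDes≈ = trans (fold-cong (𝔖 n) (λ σ → *-congˡ (trans (Π.fold-applyUpTo suc (des σ) _)
      (Π.foldTo-cong (des σ) (λ {j} _ → +-congˡ (mono-ζ (suc j))))))) (∑weightMaj≈∑codeSum m)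

    all-equal : let
      invStarred = fold (upTo n) (λ k → mono (∑ᴸ (𝔖> n k) (λ σS → q^ (inv* σS))) k)
      majStarred = fold (upTo n) (λ k → mono (∑ᴸ (𝔖> n k) (λ σS → q^ (maj* σS))) k)
      stirling = fold (applyUpTo suc n) (λ k → mono ([ k ]q! *ᴸ qStirling n k) (n ∸ k))
      invDes = fold (𝔖 n) (λ σ → Q (+ inv σ) *
        Π.fold (elements (Des σ)) (λ j → 1# + mono (q^ (- (+ (1 ℕ.+ inv□ (here j) σ)))) 1))
      invAsc = fold (𝔖 n) (λ σ → Q (+ inv σ) *
        Π.fold (elements (Asc σ)) (λ j → 1# + mono (q^ (- (+ inv□ (next j) σ))) 1))
      majDes = fold (𝔖 n) (λ σ → Q (+ maj σ) *
        Π.fold (applyUpTo suc (des σ)) (λ j → 1# + mono (q^ (- (+ j))) 1))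
      in (invStarred ≈ majStarred) × (majStarred ≈ stirling) × (stirling ≈ invDes)
         × (invDes ≈ invAsc) × (invAsc ≈ majDes)
    all-equal = trans invStarred≈ (sym majStarred≈) , trans majStarred≈ (sym stirling≈)
      , trans stirling≈ (sym invDes≈) , trans invDes≈ (sym invAsc≈) , trans invAsc≈ (sym majDes≈)

module PolyProperties = MonoidRingProperties ℤ[q^±1].rawRing L.isCommutativeRing
  ℕ._+_ 0 ℕ._≟_ ℕ.+-0-isCommutativeMonoid

polyRing : CommutativeRing 0ℓ 0ℓ
polyRing = PolyProperties.monoidRing

module P = CommutativeRing polyRing

polynomials : GradedHomomorphism
polynomials = record
  { commutativeRing = polyRing
  ; mono      = _·z^_
  ; mono-cong = PolyProperties.monomial-cong
  ; mono-0    = PolyProperties.monomial-0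
  ; mono-+    = PolyProperties.monomial-+
  ; mono-1    = P.refl {1ᴾ}
  -- The product of two one-term lists computes to the one-term list with multiplied coefficients
  -- and added exponents.
  ; mono-*    = λ c d j k → P.refl {(c *ᴸ d) ·z^ (j ℕ.+ k)}
  }

open import Data.Nat.Base using (_+_)

theorem4p2p2 : ∀ (n : ℕ) → 1 ≤ n →
    let
    invStarred = ∑ᴾ (upTo n) (λ k → ∑ᴸ (𝔖> n k) (λ σS → q^ (inv* σS)) ·z^ k)
    majStarred = ∑ᴾ (upTo n) (λ k → ∑ᴸ (𝔖> n k) (λ σS → q^ (maj* σS)) ·z^ k)
    stirling = ∑ᴾ (applyUpTo suc n) (λ k → ([ k ]q! *ᴸ qStirling n k) ·z^ (n ∸ k))
    invDes = ∑ᴾ (𝔖 n) (λ σ →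
      (q^ (+ inv σ) ·z^ 0) *ᴾ
      ∏ᴾ (elements (Des σ)) (λ j → 1ᴾ +ᴾ q^ (- (+ (1 + inv□ (here j) σ))) ·z^ 1))
    invAsc = ∑ᴾ (𝔖 n) (λ σ →
      (q^ (+ inv σ) ·z^ 0) *ᴾ
      ∏ᴾ (elements (Asc σ)) (λ j → 1ᴾ +ᴾ q^ (- (+ inv□ (next j) σ)) ·z^ 1))
    majDes = ∑ᴾ (𝔖 n) (λ σ →
      (q^ (+ maj σ) ·z^ 0) *ᴾ
      ∏ᴾ (applyUpTo suc (des σ)) (λ j → 1ᴾ +ᴾ q^ (- (+ j)) ·z^ 1))
    in (invStarred ≈ᴾ majStarred) × (majStarred ≈ᴾ stirling) × (stirling ≈ᴾ invDes)
       × (invDes ≈ᴾ invAsc) × (invAsc ≈ᴾ majDes)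
theorem4p2p2 (suc m) (s≤s z≤n) = GradedSums.all-equal polynomials m
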